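{- Let $G$ be a connected graph of order $n$ with $r$ cut edges such that $SO(G)$ is maximum among all connected graphs of order $n$ with $r$ cut edges. Then $G$ is isomorphic to the graph obtained by attaching $r$ pendent edges to a single vertex of the complete graph $K_{n-r}$.
   Context: All graphs are finite and simple. A cut edge of a connected graph $G$ is an edge $uv$ such that $G-uv$ is disconnected. For a graph $G$ with edge set $E(G)$ and vertex degrees $d_G(v)$, the Sombor index is $SO(G)=\sum_{uv\in E(G)}\sqrt{d_G(u)^2+d_G(v)^2}$. Attaching a pendent edge to a vertex $w$ means adding a new vertex adjacent only to $w$. -}

module Defs where

open import Data.Bool using (Bool; true; false; _∧_; _∨_; not; if_then_else_)
open import Data.Nat using (ℕ; zero; suc; _+_; _*_; _^_; _≤_; _<_; _∸_; _≡ᵇ_; _<ᵇ_; _≤ᵇ_)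
open import Data.Fin using (Fin; toℕ)
open import Data.List using (List; []; _∷_; map; length; filterᵇ; concatMap; allFin)
open import Data.Nat.ListAction using (sum)
open import Data.List.Relation.Unary.All using (All)
open import Data.List.Relation.Unary.Unique.Propositional using (Unique)
open import Data.List.Membership.Propositional using (_∈_)
open import Data.Product using (Σ; _×_; _,_)
open import Function.Bundles using (_↔_; Inverse)
open import Relation.Binary.PropositionalEquality using (_≡_)
open import Relation.Nullary using (¬_)

Adj : ℕ → Set
Adj n = Fin n → Fin n → Bool

record Graph (n : ℕ) : Set where
  field
    adj    : Adj n
    sym    : ∀ i j → adj i j ≡ adj j i
    irrefl : ∀ i → adj i i ≡ false
open Graph public

_==_ : ∀ {n} → Fin n → Fin n → Bool
i == j = toℕ i ≡ᵇ toℕ j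

data Reach {n : ℕ} (A : Adj n) : Fin n → Fin n → Set where
  here : ∀ {i} → Reach A i i
  step : ∀ {i j k} → A i j ≡ true → Reach A j k → Reach A i k

ConnectedAdj : ∀ {n} → Adj n → Set
ConnectedAdj {n} A = (0 < n) × (∀ i j → Reach A i j)

Connected : ∀ {n} → Graph n → Set
Connected G = ConnectedAdj (adj G)

deleteEdge : ∀ {n} → Adj n → Fin n → Fin n → Adj n
deleteEdge A u v i j =
  A i j ∧ not ((i == u ∧ j == v) ∨ (i == v ∧ j == u))

IsCutEdge : ∀ {n} → Graph n → Fin n × Fin n → Set
IsCutEdge G (u , v) =
  (toℕ u < toℕ v) × (adj G u v ≡ true) × ¬ ConnectedAdj (deleteEdge (adj G) u v)

HasCutEdges : ∀ {n} → Graph n → ℕ → Set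
HasCutEdges {n} G r =
  Σ (List (Fin n × Fin n)) λ es →
    (length es ≡ r) × Unique es × All (IsCutEdge G) es
    × (∀ e → IsCutEdge G e → e ∈ es)

degree : ∀ {n} → Graph n → Fin n → ℕ
degree {n} G i = length (filterᵇ (λ j → adj G i j) (allFin n))

edges : ∀ {n} → Graph n → List (Fin n × Fin n)
edges {n} G =
  concatMap (λ i → concatMap (λ j →
      if (toℕ i <ᵇ toℕ j) ∧ adj G i j then (i , j) ∷ [] else [])
    (allFin n)) (allFin n)

-- SO(G) = Σ_{uv ∈ E} sqrt(a_uv), with a_uv = d(u)^2 + d(v)^2.
-- We record the list of radicands a_uv.
sombor-radicands : ∀ {n} → Graph n → List ℕ
sombor-radicands G =
  map (λ { (u , v) → degree G u ^ 2 + degree G v ^ 2 }) (edges G)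

isqrt : ℕ → ℕ
isqrt zero = zero
isqrt (suc m) with isqrt m
... | s = if (suc s * suc s) ≤ᵇ suc m then suc s else s

-- Real comparison  Σ_{a∈as} √a ≤ Σ_{b∈bs} √b , expressed exactly via
-- dyadic approximations: for every k,
--   Σ ⌊2^k √a⌋ ≤ Σ (⌊2^k √b⌋ + 1).
-- (This is equivalent to the real inequality.)
SqrtSum≤ : List ℕ → List ℕ → Set
SqrtSum≤ as bs = ∀ k →
  sum (map (λ a → isqrt (a * 4 ^ k)) as)
    ≤ sum (map (λ b → suc (isqrt (b * 4 ^ k))) bs)

SO≤ : ∀ {n m} → Graph n → Graph m → Set
SO≤ G H = SqrtSum≤ (sombor-radicands G) (sombor-radicands H)

-- Extremal graph: K_{n-r} on vertices {0,…,n-r-1}, with r pendent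
-- vertices {n-r,…,n-1} all attached to vertex 0.

inK : ∀ {n} → ℕ → Fin n → Bool
inK {n} r i = toℕ i <ᵇ (n ∸ r)

isZero : ∀ {n} → Fin n → Bool
isZero i = toℕ i ≡ᵇ 0

KPendant : (n r : ℕ) → Adj n
KPendant n r i j =
  not (i == j) ∧
    ((inK r i ∧ inK r j)
     ∨ (isZero i ∧ not (inK r j))
     ∨ (isZero j ∧ not (inK r i)))

IsomorphicTo : ∀ {n} → Graph n → Adj n → Set
IsomorphicTo {n} G B =
  Σ (Fin n ↔ Fin n) λ f →
    ∀ i j → adj G i j ≡ B (Inverse.to f i) (Inverse.to f j)

{-# OPTIONS --safe #-}
module Submission where

-- Contract the r cut edges: they form a forest, so n - r = t + 1 classes remain, and between
-- two classes there is at most one non-cut edge.  Write c(v) and k(v) for the number of cut and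
-- non-cut edges at v.  The contraction gives Σ k ≤ (t + 1) t, as well as k(u) + k(v) ≤ t for a
-- cut edge uv and c(u) + c(v) ≤ r for a non-cut edge uv.
--
-- A cut edge has d(u) + d(v) ≤ n, so it contributes at most √((n - 1)² + 1).  For a non-cut edge,
-- convexity of the norm, applied to r (t + c(u) , t + c(v)) as a combination of (t + r , t),
-- (t , t + r) and (t , t), bounds its contribution linearly in c(u) + c(v); the sum of these
-- bounds is controlled by Σ c k = Σ over cut edges of (k(u) + k(v)) ≤ r t.  The total is exactly
-- the Sombor index of the pendant clique.
--
-- In the case of equality every cut edge joins a vertex of degree n - 1 to a leaf, hence all cut
-- edges share one hub, and the remaining t + 1 vertices are pairwise adjacent.
--
-- Sums of square roots are compared through their dyadic approximations, where all the
-- inequalities hold up to an error independent of the precision.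

open import Defs
open import Data.Bool using (Bool; true; false; not; _∧_; _∨_; if_then_else_; T)
import Data.Bool.Properties as Bool
open import Data.Empty using (⊥)
open import Data.Fin using (Fin; zero; suc; toℕ; punchIn; punchOut; _↑ˡ_; _↑ʳ_; splitAt; join)
import Data.Fin as Fin
open import Data.Fin.Permutation as Perm using (Permutation; _⟨$⟩ʳ_; insert; insert-punchIn)
import Data.Fin.Properties as Fin
open import Data.List using (List; []; _∷_; _++_; map; concatMap; length; filter; filterᵇ; tabulate; allFin; cartesianProduct)
open import Data.List.Membership.Propositional using (_∈_; _∉_)
open import Data.List.Membership.Propositional.Properties using (∈-filter⁺; ∈-filter⁻; ∈-cartesianProduct⁺; ∈-allFin; ∈-tabulate⁺)
import Data.List.Properties as List using (map-++; map-∘; map-cong; length-tabulate)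
open import Data.List.Relation.Unary.All as All using (All; []; _∷_)
import Data.List.Relation.Unary.All.Properties as All using (tabulate⁺)
open import Data.List.Relation.Unary.AllPairs using ([]; _∷_)
open import Data.List.Relation.Unary.Any using (here; there)
open import Data.List.Relation.Unary.Unique.Propositional using (Unique)
import Data.List.Relation.Unary.Unique.Propositional.Properties as Unique using (tabulate⁺)
open import Data.Nat
import Data.Nat.ListAction as List
import Data.Nat.ListAction.Properties as List
open import Data.Nat.Properties
open import Data.Nat.Tactic.RingSolver using (solve-∀)
open import Data.Product using (Σ; ∃; _×_; _,_; proj₁; proj₂)
import Data.Product.Properties as Product
open import Data.Sum as Sum using (_⊎_; inj₁; inj₂)
open import Data.Unit using (tt)
open import Function using (_∘_; id; Equivalence; _⟨_⟩_)
open import Function.Bundles using (Injection)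
open import Function.Properties.Inverse using (↔⇒↣)
open import Relation.Binary.Definitions using (tri<; tri≈; tri>)
open import Relation.Binary.PropositionalEquality using (_≡_; _≢_; refl; trans; cong; cong₂; subst; subst₂; module ≡-Reasoning) renaming (sym to ≡-sym)
open import Relation.Binary.Structures using (IsEquivalence)
open import Relation.Nullary using (¬_; Dec; does; yes; no; contradiction)
open import Relation.Nullary.Decidable using (dec-true; dec-false)
open import Algebra.Properties.Semiring.Sum +-*-semiring
  using (sum; sum-syntax; sum-cong-≗; sum-remove; ∑-distrib-+; ∑-comm; *-distribˡ-sum; *-distribʳ-sum)

-- Dyadic square roots

-- Two obstacles shape the proof. Maximality may be applied only to a graph with exactly r cut
-- edges. The pendant clique is one unless n - r = 2, when its clique edge is a cut edge too. That
-- case is excluded on the side of G: the only edge between two classes would be a cut edge, and so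
-- would have been contracted. The other obstacle is that a comparison of real sums is available
-- only as a family of integer inequalities, one for each precision k, each with rounding errors.
-- Equality in a bound therefore cannot be read off at any single k. Instead a strict loss would
-- grow like 2^k, against an error that does not depend on k. For this the losses have to separate:
-- the hub-to-clique weights cancel identically, a missing non-cut edge then costs a full weight
-- √(t² + t²), and a cut edge with the wrong degrees costs its own shortfall. The first loss is
-- excluded before the second, because the second argument needs the clique weights to cancel
-- exactly. Sums run over ordered pairs, so every count is doubled and no halving occurs.

isqrt-lower : ∀ n → isqrt n * isqrt n ≤ n
isqrt-lower zero = z≤n
isqrt-lower (suc m) with isqrt m | isqrt-lower m
... | s | ss≤m with (suc s * suc s) ≤ᵇ suc m in eq
... | true  = ≤ᵇ⇒≤ (suc s * suc s) (suc m) (subst T (≡-sym eq) tt)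
... | false = m≤n⇒m≤1+n ss≤m

isqrt-upper : ∀ n → n < suc (isqrt n) * suc (isqrt n)
isqrt-upper zero = s≤s z≤n
isqrt-upper (suc m) with isqrt m | isqrt-upper m
... | s | m<ss with (suc s * suc s) ≤ᵇ suc m in eq
... | true  = ≤-<-trans m<ss (*-mono-< (n<1+n (suc s)) (n<1+n (suc s)))
... | false = ≰⇒> λ le → subst T eq (≤⇒≤ᵇ le)

square-cancel-< : ∀ {x y} → x * x < y * y → x < y
square-cancel-< {x} {y} xx<yy with x <? y
... | yes x<y = x<y
... | no  x≮y = contradiction xx<yy (≤⇒≯ (*-mono-≤ (≮⇒≥ x≮y) (≮⇒≥ x≮y)))

square-cancel-≤ : ∀ {x y} → x * x ≤ y * y → x ≤ y
square-cancel-≤ {x} {y} xx≤yy with x ≤? y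
... | yes x≤y = x≤y
... | no  x≰y = contradiction xx≤yy (<⇒≱ (*-mono-< (≰⇒> x≰y) (≰⇒> x≰y)))

isqrt-mono : ∀ {a b} → a ≤ b → isqrt a ≤ isqrt b
isqrt-mono {a} {b} a≤b = ≤-pred (square-cancel-< (≤-<-trans (≤-trans (isqrt-lower a) a≤b) (isqrt-upper b)))

-- ⌊2^k √a⌋
√_at_ : ℕ → ℕ → ℕ
√ a at k = isqrt (a * 4 ^ k)

√-mono : ∀ {a b} k → a ≤ b → √ a at k ≤ √ b at k
√-mono k a≤b = isqrt-mono (*-monoˡ-≤ (4 ^ k) a≤b)

4^k≡2^k*2^k : ∀ k → 4 ^ k ≡ 2 ^ k * 2 ^ k
4^k≡2^k*2^k k = ^-distribʳ-* k 2 2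
  where
  ^-distribʳ-* : ∀ k a b → (a * b) ^ k ≡ a ^ k * b ^ k
  ^-distribʳ-* zero    a b = refl
  ^-distribʳ-* (suc k) a b rewrite ^-distribʳ-* k a b = lemma a b (a ^ k) (b ^ k)
    where
    lemma : ∀ a b x y → a * b * (x * y) ≡ a * x * (b * y)
    lemma = solve-∀

n<2^n : ∀ n → n < 2 ^ n
n<2^n zero    = s≤s z≤n
n<2^n (suc n) = begin-strict
  suc n               ≡⟨ +-comm 1 n ⟩
  n + 1               <⟨ +-mono-<-≤ (n<2^n n) (m^n>0 2 n) ⟩
  2 ^ n + 2 ^ n       ≡⟨ cong (2 ^ n +_) (+-identityʳ (2 ^ n)) ⟨
  2 * 2 ^ n           ∎
  where open ≤-Reasoning

-- The scaled roots differ by about 2^k (√b - √a), which exceeds any fixed C. This is the device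
-- that turns bounds with a fixed error into exact statements.
√-gap-unbounded : ∀ {a b} C → a < b → ¬ (∀ k → √ b at k ≤ √ a at k + C)
√-gap-unbounded {a} {b} C a<b bound = <-irrefl refl (begin-strict
  b * (N * N)                              ≡⟨ cong (b *_) (4^k≡2^k*2^k k) ⟨
  b * 4 ^ k                                <⟨ isqrt-upper (b * 4 ^ k) ⟩
  suc (√ b at k) * suc (√ b at k)          ≤⟨ *-mono-≤ (s≤s (bound k)) (s≤s (bound k)) ⟩
  suc (s + C) * suc (s + C)                ≡⟨ expand s C ⟩
  s * s + (suc C * s * 2 + suc C * suc C)  ≤⟨ +-mono-≤ (isqrt-lower (a * 4 ^ k)) (+-monoˡ-≤ _ (*-monoˡ-≤ 2 (*-monoʳ-≤ (suc C) s≤aN))) ⟩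
  a * 4 ^ k + (suc C * (a * N) * 2 + suc C * suc C)      ≡⟨ cong (λ x → a * x + (suc C * (a * N) * 2 + suc C * suc C)) (4^k≡2^k*2^k k) ⟩
  a * (N * N) + (suc C * (a * N) * 2 + suc C * suc C)    ≤⟨ +-monoʳ-≤ (a * (N * N)) (+-monoʳ-≤ (suc C * (a * N) * 2) (m≤m*n (suc C * suc C) N {{m^n≢0 2 k}})) ⟩
  a * (N * N) + (suc C * (a * N) * 2 + suc C * suc C * N) ≡⟨ cong (a * (N * N) +_) (collect (suc C) a N) ⟩
  a * (N * N) + k * N                      ≤⟨ +-monoʳ-≤ (a * (N * N)) (*-monoˡ-≤ N (<⇒≤ (n<2^n k))) ⟩
  a * (N * N) + N * N                      ≡⟨ +-comm (a * (N * N)) (N * N) ⟩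
  suc a * (N * N)                          ≤⟨ *-monoˡ-≤ (N * N) a<b ⟩
  b * (N * N)                              ∎)
  where
  open ≤-Reasoning
  k N s : ℕ
  -- With c = C + 1 and s ≤ aN, the square (s + c)² exceeds s² by at most (2ca + c²) N. This k is
  -- that coefficient, and k < 2^k = N makes the excess at most N², the room between a N² and b N².
  k = suc C * a * 2 + suc C * suc C
  N = 2 ^ k
  s = √ a at k
  expand : ∀ s C → suc (s + C) * suc (s + C) ≡ s * s + (suc C * s * 2 + suc C * suc C)
  expand = solve-∀
  collect : ∀ c a N → c * (a * N) * 2 + c * c * N ≡ (c * a * 2 + c * c) * N
  collect = solve-∀
  square-of-product : ∀ a N → a * N * (a * N) ≡ a * a * (N * N)
  square-of-product = solve-∀
  n≤n*n : ∀ n → n ≤ n * n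
  n≤n*n zero    = z≤n
  n≤n*n (suc n) = m≤m*n (suc n) (suc n)
  s≤aN : s ≤ a * N
  s≤aN = square-cancel-≤ (begin
    s * s             ≤⟨ isqrt-lower (a * 4 ^ k) ⟩
    a * 4 ^ k         ≡⟨ cong (a *_) (4^k≡2^k*2^k k) ⟩
    a * (N * N)       ≤⟨ *-monoˡ-≤ (N * N) (n≤n*n a) ⟩
    a * a * (N * N)   ≡⟨ square-of-product a N ⟨
    a * N * (a * N)   ∎)

√-unbounded : ∀ {b} C → 0 < b → ¬ (∀ k → √ b at k ≤ C)
√-unbounded C = √-gap-unbounded {0} C

-- The triangle inequality for
-- r (t + p , t + q) = p (t + r , t) + q (t , t + r) + s (t , t).
norm-convex : ∀ t p q s {N S A B} → let r = p + q + s in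
  S * S ≤ ((t + p) * (t + p) + (t + q) * (t + q)) * N →
  ((t + r) * (t + r) + t * t) * N ≤ A * A →
  (t * t + t * t) * N ≤ B * B →
  r * S ≤ (p + q) * A + s * B
norm-convex t p q s {N} {S} {A} {B} hS hA hB = square-cancel-≤ (begin
  r * S * (r * S)            ≡⟨ swap r S ⟩
  r * r * (S * S)            ≤⟨ *-monoʳ-≤ (r * r) hS ⟩
  r * r * (((t + p) * (t + p) + (t + q) * (t + q)) * N)
    -- The vectors (t + r , t) and (t , t + r) have equal norm, so both may be replaced by the
    -- first. The added term is 2pq times the norm squared minus their inner product, which is r².
    ≤⟨ m≤m+n _ (2 * p * q * (r * r) * N) ⟩
  r * r * (((t + p) * (t + p) + (t + q) * (t + q)) * N) + 2 * p * q * (r * r) * N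
    ≡⟨ expand t p q s N ⟩
  (p + q) * (p + q) * (((t + r) * (t + r) + t * t) * N) + s * s * ((t * t + t * t) * N) + 2 * (p + q) * s * (N * (t * (t + t + r)))
    ≤⟨ +-mono-≤ (+-mono-≤ (*-monoʳ-≤ ((p + q) * (p + q)) hA) (*-monoʳ-≤ (s * s) hB)) (*-monoʳ-≤ (2 * (p + q) * s) inner≤AB) ⟩
  (p + q) * (p + q) * (A * A) + s * s * (B * B) + 2 * (p + q) * s * (A * B)
    ≡⟨ square (p + q) s A B ⟨
  ((p + q) * A + s * B) * ((p + q) * A + s * B) ∎)
  where
  open ≤-Reasoning
  r : ℕ
  r = p + q + s
  swap : ∀ r S → r * S * (r * S) ≡ r * r * (S * S)
  swap = solve-∀
  expand : ∀ t p q s N →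
    (p + q + s) * (p + q + s) * (((t + p) * (t + p) + (t + q) * (t + q)) * N) + 2 * p * q * ((p + q + s) * (p + q + s)) * N
    ≡ (p + q) * (p + q) * (((t + (p + q + s)) * (t + (p + q + s)) + t * t) * N) + s * s * ((t * t + t * t) * N)
      + 2 * (p + q) * s * (N * (t * (t + t + (p + q + s))))
  expand = solve-∀
  square : ∀ a s A B → (a * A + s * B) * (a * A + s * B) ≡ a * a * (A * A) + s * s * (B * B) + 2 * a * s * (A * B)
  square = solve-∀
  -- Lagrange's identity for (t + r , t) and (t , t): their inner product is t (2t + r) and their
  -- determinant is rt.
  cauchy : ∀ t r N → N * (t * (t + t + r)) * (N * (t * (t + t + r))) + N * N * (t * t) * (r * r)
    ≡ ((t + r) * (t + r) + t * t) * N * ((t * t + t * t) * N)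
  cauchy = solve-∀
  inner≤AB : N * (t * (t + t + r)) ≤ A * B
  inner≤AB = square-cancel-≤ (begin
    N * (t * (t + t + r)) * (N * (t * (t + t + r)))  ≤⟨ m≤m+n _ (N * N * (t * t) * (r * r)) ⟩
    N * (t * (t + t + r)) * (N * (t * (t + t + r))) + N * N * (t * t) * (r * r) ≡⟨ cauchy t r N ⟩
    ((t + r) * (t + r) + t * t) * N * ((t * t + t * t) * N) ≤⟨ *-mono-≤ hA hB ⟩
    A * A * (B * B)                                  ≡⟨ swap A B ⟨
    A * B * (A * B)                                  ∎)

x^2+y^2 : ∀ x y → x ^ 2 + y ^ 2 ≡ x * x + y * y
x^2+y^2 x y = cong₂ (λ u v → x * u + y * v) (*-identityʳ x) (*-identityʳ y)

√-convex : ∀ k t p q s → let r = p + q + s in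
  r * √ ((t + p) ^ 2 + (t + q) ^ 2) at k
    ≤ (p + q) * suc (√ ((t + r) ^ 2 + t ^ 2) at k) + s * suc (√ (t ^ 2 + t ^ 2) at k)
√-convex k t p q s
  rewrite x^2+y^2 (t + p) (t + q) | x^2+y^2 (t + (p + q + s)) t | x^2+y^2 t t
  = norm-convex t p q s (isqrt-lower _) (<⇒≤ (isqrt-upper _)) (<⇒≤ (isqrt-upper _))

-- Sums of two squares when the sum of the bases is bounded

private
  pred-sum≤ : ∀ x y z → suc x + suc y ≤ suc (suc z) → x + y ≤ z
  pred-sum≤ x y z (s≤s h) = ≤-pred (subst (_≤ suc z) (+-suc x y) h)

-- After shifting both numbers down by 1, the two sides differ by 2xy when x + y is as large as
-- allowed. In the extremal case this product vanishes, so one of the original numbers is 1.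
sum-of-squares≤ : ∀ {n x y} → 0 < x → 0 < y → x + y ≤ suc n → x ^ 2 + y ^ 2 ≤ n ^ 2 + 1 ^ 2
sum-of-squares≤ {zero} {suc x} {suc y} _ _ (s≤s h) = contradiction (subst (_≤ 0) (+-suc x y) h) λ ()
sum-of-squares≤ {suc z} {suc x} {suc y} _ _ h = begin
  suc x ^ 2 + suc y ^ 2                       ≡⟨ x^2+y^2 (suc x) (suc y) ⟩
  suc x * suc x + suc y * suc y               ≤⟨ m≤m+n _ (x * y + x * y) ⟩
  suc x * suc x + suc y * suc y + (x * y + x * y) ≡⟨ expand x y ⟩
  suc (x + y) * suc (x + y) + 1 * 1           ≤⟨ +-monoˡ-≤ 1 (*-mono-≤ (s≤s (pred-sum≤ x y z h)) (s≤s (pred-sum≤ x y z h))) ⟩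
  suc z * suc z + 1 * 1                       ≡⟨ x^2+y^2 (suc z) 1 ⟨
  suc z ^ 2 + 1 ^ 2                           ∎
  where
  open ≤-Reasoning
  expand : ∀ x y → suc x * suc x + suc y * suc y + (x * y + x * y) ≡ suc (x + y) * suc (x + y) + 1 * 1
  expand = solve-∀

sum-of-squares-extremal : ∀ {n x y} → 0 < x → 0 < y → x + y ≤ suc n → n ^ 2 + 1 ^ 2 ≤ x ^ 2 + y ^ 2 →
  (x ≡ n × y ≡ 1) ⊎ (x ≡ 1 × y ≡ n)
sum-of-squares-extremal {zero} {suc x} {suc y} _ _ (s≤s h) _ = contradiction (subst (_≤ 0) (+-suc x y) h) λ ()
sum-of-squares-extremal {suc z} {suc x} {suc y} _ _ h big with pred-sum≤ x y z h
... | x+y≤z = split (m*n≡0⇒m≡0∨n≡0 x (n≤0⇒n≡0 (+-cancelˡ-≤ (suc x * suc x + suc y * suc y) (x * y) 0 (begin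
  suc x * suc x + suc y * suc y + x * y           ≤⟨ +-monoʳ-≤ (suc x * suc x + suc y * suc y) (m≤m+n (x * y) (x * y)) ⟩
  suc x * suc x + suc y * suc y + (x * y + x * y) ≡⟨ expand x y ⟩
  suc (x + y) * suc (x + y) + 1 * 1               ≤⟨ squares≤ ⟩
  suc x * suc x + suc y * suc y                   ≡⟨ +-identityʳ _ ⟨
  suc x * suc x + suc y * suc y + 0               ∎))))
  where
  open ≤-Reasoning
  expand : ∀ x y → suc x * suc x + suc y * suc y + (x * y + x * y) ≡ suc (x + y) * suc (x + y) + 1 * 1
  expand = solve-∀
  big′ : suc z * suc z + 1 * 1 ≤ suc x * suc x + suc y * suc y
  big′ = subst₂ _≤_ (x^2+y^2 (suc z) 1) (x^2+y^2 (suc x) (suc y)) big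
  squares≤ : suc (x + y) * suc (x + y) + 1 * 1 ≤ suc x * suc x + suc y * suc y
  squares≤ = ≤-trans (+-monoˡ-≤ 1 (*-mono-≤ (s≤s x+y≤z) (s≤s x+y≤z))) big′
  z≤ : ∀ w → suc z * suc z + 1 * 1 ≤ suc w * suc w + 1 * 1 → z ≤ w
  z≤ w le = ≤-pred (square-cancel-≤ (+-cancelʳ-≤ 1 (suc z * suc z) (suc w * suc w) le))
  split : x ≡ 0 ⊎ y ≡ 0 → (suc x ≡ suc z × suc y ≡ 1) ⊎ (suc x ≡ 1 × suc y ≡ suc z)
  split (inj₁ refl) = inj₂ (refl , cong suc (≤-antisym x+y≤z (z≤ y (≤-trans big′ (≤-reflexive (+-comm (1 * 1) (suc y * suc y)))))))
  split (inj₂ refl) = inj₁ (cong suc (≤-antisym (subst (_≤ z) (+-identityʳ x) x+y≤z) (z≤ x big′)) , refl)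

-- Finite sums

⟦_⟧ : Bool → ℕ
⟦ true ⟧  = 1
⟦ false ⟧ = 0

⟦⟧≤1 : ∀ b → ⟦ b ⟧ ≤ 1
⟦⟧≤1 true  = ≤-refl
⟦⟧≤1 false = z≤n

0<⟦⟧ : ∀ {b} → 0 < ⟦ b ⟧ → b ≡ true
0<⟦⟧ {true} _ = refl

sum-mono : ∀ {n} {f g : Fin n → ℕ} → (∀ i → f i ≤ g i) → sum f ≤ sum g
sum-mono {zero}  f≤g = z≤n
sum-mono {suc n} f≤g = +-mono-≤ (f≤g zero) (sum-mono (f≤g ∘ suc))

sum-const : ∀ n c → ∑[ i < n ] c ≡ n * c
sum-const zero    c = refl
sum-const (suc n) c = cong (c +_) (sum-const n c)

sum-zero : ∀ {n} {f : Fin n → ℕ} → (∀ i → f i ≡ 0) → sum f ≡ 0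
sum-zero {zero}  f≡0 = refl
sum-zero {suc n} f≡0 = cong₂ _+_ (f≡0 zero) (sum-zero (f≡0 ∘ suc))

term≤sum : ∀ {n} (f : Fin n → ℕ) i → f i ≤ sum f
term≤sum f zero    = m≤m+n _ _
term≤sum f (suc i) = ≤-trans (term≤sum (f ∘ suc) i) (m≤n+m _ _)

two-terms≤sum : ∀ {n} (f : Fin n → ℕ) {i j} → i ≢ j → f i + f j ≤ sum f
two-terms≤sum f {zero}  {zero}  i≢j = contradiction refl i≢j
two-terms≤sum f {zero}  {suc j} i≢j = +-monoʳ-≤ (f zero) (term≤sum (f ∘ suc) j)
two-terms≤sum f {suc i} {zero}  i≢j = ≤-trans (≤-reflexive (+-comm (f (suc i)) (f zero))) (+-monoʳ-≤ (f zero) (term≤sum (f ∘ suc) i))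
two-terms≤sum f {suc i} {suc j} i≢j = ≤-trans (two-terms≤sum (f ∘ suc) (i≢j ∘ cong suc)) (m≤n+m _ _)

sum-extremal : ∀ {n} {f g : Fin n → ℕ} → (∀ i → f i ≤ g i) → sum g ≤ sum f → ∀ i → f i ≡ g i
sum-extremal {suc n} {f} {g} f≤g ∑g≤∑f = λ where
    zero    → ≤-antisym (f≤g zero) (+-cancelʳ-≤ (sum (g ∘ suc)) _ _ (≤-trans ∑g≤∑f (+-monoʳ-≤ (f zero) (sum-mono (f≤g ∘ suc)))))
    (suc i) → sum-extremal (f≤g ∘ suc) (+-cancelˡ-≤ (g zero) _ _ (≤-trans ∑g≤∑f (+-monoˡ-≤ (sum (f ∘ suc)) (f≤g zero)))) i

sum-positive : ∀ {n} (f : Fin n → ℕ) → 0 < sum f → ∃ λ i → 0 < f i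
sum-positive {suc n} f 0<∑ with f zero in eq
... | suc m = zero , subst (0 <_) (≡-sym eq) (s≤s z≤n)
... | zero with sum-positive (f ∘ suc) 0<∑
...   | i , 0<fi = suc i , 0<fi

sum≤1 : ∀ {n} (f : Fin n → ℕ) → (∀ i → f i ≤ 1) → (∀ i j → 0 < f i → 0 < f j → i ≡ j) → sum f ≤ 1
sum≤1 f f≤1 unique with sum f ≤? 1
... | yes ∑≤1 = ∑≤1
sum≤1 {zero}  f f≤1 unique | no ∑≰1 = contradiction z≤n ∑≰1
sum≤1 {suc n} f f≤1 unique | no ∑≰1 with f zero in eq
... | zero  = contradiction (sum≤1 (f ∘ suc) (f≤1 ∘ suc) λ i j p q → Fin.suc-injective (unique (suc i) (suc j) p q)) ∑≰1
... | suc m with sum-positive (f ∘ suc) (+-cancelˡ-< (suc m) 0 _ (≤-<-trans (≤-reflexive (+-identityʳ (suc m))) (≤-<-trans (subst (_≤ 1) eq (f≤1 zero)) (≰⇒> ∑≰1))))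
...   | i , 0<fi = contradiction (unique zero (suc i) (subst (0 <_) (≡-sym eq) (s≤s z≤n)) 0<fi) λ ()

sum-delta : ∀ {n} (f : Fin n → ℕ) a → ∑[ i < n ] (⟦ does (a Fin.≟ i) ⟧ * f i) ≡ f a
sum-delta {suc n} f zero = begin
  f zero + 0 + ∑[ i < n ] 0 ≡⟨ cong (f zero + 0 +_) (trans (sum-const n 0) (*-zeroʳ n)) ⟩
  f zero + 0 + 0            ≡⟨ trans (+-identityʳ _) (+-identityʳ _) ⟩
  f zero                    ∎
  where open ≡-Reasoning
sum-delta {suc n} f (suc a) = sum-delta (f ∘ suc) a

sum-fibre : ∀ {n m} (ρ : Fin n → Fin m) (f : Fin n → ℕ) →
  sum f ≡ ∑[ a < m ] ∑[ i < n ] (⟦ does (ρ i Fin.≟ a) ⟧ * f i)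
sum-fibre {n} {m} ρ f = begin
  ∑[ i < n ] f i                                       ≡⟨ sum-cong-≗ (λ i → ≡-sym (sum-delta (λ _ → f i) (ρ i))) ⟩
  ∑[ i < n ] ∑[ a < m ] (⟦ does (ρ i Fin.≟ a) ⟧ * f i) ≡⟨ ∑-comm (λ i a → ⟦ does (ρ i Fin.≟ a) ⟧ * f i) ⟩
  ∑[ a < m ] ∑[ i < n ] (⟦ does (ρ i Fin.≟ a) ⟧ * f i) ∎
  where open ≡-Reasoning

sum-without : ∀ {n} (f : Fin n → ℕ) a → ∑[ i < n ] (⟦ not (does (a Fin.≟ i)) ⟧ * f i) + f a ≡ sum f
sum-without {n} f a = begin
  ∑[ i < n ] (⟦ not (does (a Fin.≟ i)) ⟧ * f i) + f a
    ≡⟨ cong (∑[ i < n ] (⟦ not (does (a Fin.≟ i)) ⟧ * f i) +_) (sum-delta f a) ⟨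
  ∑[ i < n ] (⟦ not (does (a Fin.≟ i)) ⟧ * f i) + ∑[ i < n ] (⟦ does (a Fin.≟ i) ⟧ * f i)
    ≡⟨ ∑-distrib-+ (λ i → ⟦ not (does (a Fin.≟ i)) ⟧ * f i) (λ i → ⟦ does (a Fin.≟ i) ⟧ * f i) ⟨
  ∑[ i < n ] (⟦ not (does (a Fin.≟ i)) ⟧ * f i + ⟦ does (a Fin.≟ i) ⟧ * f i)
    ≡⟨ sum-cong-≗ (λ i → either (does (a Fin.≟ i)) (f i)) ⟩
  sum f ∎
  where
  open ≡-Reasoning
  either : ∀ b x → ⟦ not b ⟧ * x + ⟦ b ⟧ * x ≡ x
  either true  x = +-identityʳ x
  either false x = trans (+-identityʳ (x + 0)) (+-identityʳ x)

-- Connected components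

reach-trans : ∀ {n} {A : Adj n} {i j k} → Reach A i j → Reach A j k → Reach A i k
reach-trans here       q = q
reach-trans (step e p) q = step e (reach-trans p q)

reach-sym : ∀ {n} {A : Adj n} → (∀ i j → A i j ≡ A j i) → ∀ {i j} → Reach A i j → Reach A j i
reach-sym A-sym here               = here
reach-sym A-sym (step {i} {j} e p) = reach-trans (reach-sym A-sym p) (step (trans (A-sym j i) e) here)

reach-isEquivalence : ∀ {n} {A : Adj n} → (∀ i j → A i j ≡ A j i) → IsEquivalence (Reach A)
reach-isEquivalence A-sym = record { refl = here ; sym = reach-sym A-sym ; trans = reach-trans }

reach-invariant : ∀ {n} {A : Adj n} {R : Fin n → Fin n → Set} → IsEquivalence R →
  (∀ i j → A i j ≡ true → R i j) → ∀ {i j} → Reach A i j → R i j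
reach-invariant eq A⇒R here               = IsEquivalence.refl eq
reach-invariant eq A⇒R (step {i} {j} e p) = IsEquivalence.trans eq (A⇒R i j e) (reach-invariant eq A⇒R p)

kernel-isEquivalence : ∀ {A B : Set} (f : A → B) → IsEquivalence (λ x y → f x ≡ f y)
kernel-isEquivalence f = record { refl = refl ; sym = ≡-sym ; trans = trans }

-- The kernel of label is the equivalence relation generated by es.
record Components {n : ℕ} (es : List (Fin n × Fin n)) (k : ℕ) : Set₁ where
  field
    label          : Fin n → Fin k
    representative : Fin k → Fin n
    label-representative : ∀ a → label (representative a) ≡ a
    label-edge     : All (λ (u , v) → label u ≡ label v) es
    label-minimal  : ∀ {R : Fin n → Fin n → Set} → IsEquivalence R →
      All (λ (u , v) → R u v) es → ∀ {x y} → label x ≡ label y → R x y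

open Components

no-edges : ∀ {n} → Components {n} [] n
no-edges = record
  { label                = id
  ; representative       = id
  ; label-representative = λ _ → refl
  ; label-edge           = []
  ; label-minimal        = λ eq _ x≡y → IsEquivalence.reflexive eq x≡y
  }

redundant-edge : ∀ {n k es u v} (Q : Components {n} es k) → label Q u ≡ label Q v → Components ((u , v) ∷ es) k
redundant-edge Q u≡v = record
  { label                = label Q
  ; representative       = representative Q
  ; label-representative = label-representative Q
  ; label-edge           = u≡v ∷ label-edge Q
  ; label-minimal        = λ { eq (_ ∷ all) → label-minimal Q eq all }
  }

-- Identifies the label b with a and closes the gap left at b, so that the labels again fill an
-- initial segment and their number drops by exactly one.
module Merge {k : ℕ} (a b : Fin (suc k)) (b≢a : b ≢ a) where

  merge : Fin (suc k) → Fin k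
  merge c with b Fin.≟ c
  ... | yes _   = punchOut b≢a
  ... | no b≢c = punchOut b≢c

  merge-b : merge b ≡ merge a
  merge-b with b Fin.≟ b | b Fin.≟ a
  ... | yes _   | no _    = Fin.punchOut-cong b refl
  ... | _       | yes b≡a = contradiction b≡a b≢a
  ... | no b≢b | _       = contradiction refl b≢b

  merge-punchIn : ∀ c → merge (punchIn b c) ≡ c
  merge-punchIn c with b Fin.≟ punchIn b c
  ... | yes b≡pc = contradiction (≡-sym b≡pc) (Fin.punchInᵢ≢i b c)
  ... | no b≢pc  = trans (Fin.punchOut-cong b refl) (Fin.punchOut-punchIn b)

  merge-fibres : ∀ c d → merge c ≡ merge d → c ≡ d ⊎ (c ≡ a × d ≡ b) ⊎ (c ≡ b × d ≡ a)
  merge-fibres c d eq with b Fin.≟ c | b Fin.≟ d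
  ... | yes refl | yes refl = inj₁ refl
  ... | yes refl | no b≢d   = inj₂ (inj₂ (refl , ≡-sym (Fin.punchOut-injective b≢a b≢d eq)))
  ... | no b≢c   | yes refl = inj₂ (inj₁ (Fin.punchOut-injective b≢c b≢a eq , refl))
  ... | no b≢c   | no b≢d   = inj₁ (Fin.punchOut-injective b≢c b≢d eq)

module _ {n k es u v} (Q : Components {n} es (suc k)) (v≢u : label Q v ≢ label Q u) where
  open Merge (label Q u) (label Q v) v≢u

  merging-edge : Components ((u , v) ∷ es) k
  merging-edge = record
    { label                = merge ∘ label Q
    ; representative       = representative Q ∘ punchIn (label Q v)
    ; label-representative = λ c → trans (cong merge (label-representative Q (punchIn (label Q v) c))) (merge-punchIn c)
    ; label-edge           = ≡-sym merge-b ∷ All.map (cong merge) (label-edge Q)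
    ; label-minimal        = minimal
    }
    where
    minimal : ∀ {R : Fin n → Fin n → Set} → IsEquivalence R → All (λ (x , y) → R x y) ((u , v) ∷ es) →
      ∀ {x y} → merge (label Q x) ≡ merge (label Q y) → R x y
    minimal eq (Ruv ∷ Res) {x} {y} lx≡ly with merge-fibres (label Q x) (label Q y) lx≡ly
    ... | inj₁ x~y = label-minimal Q eq Res x~y
    ... | inj₂ (inj₁ (x~u , y~v)) = IsEquivalence.trans eq (label-minimal Q eq Res x~u)
      (IsEquivalence.trans eq Ruv (label-minimal Q eq Res (≡-sym y~v)))
    ... | inj₂ (inj₂ (x~v , y~u)) = IsEquivalence.trans eq (label-minimal Q eq Res x~v)
      (IsEquivalence.trans eq (IsEquivalence.sym eq Ruv) (label-minimal Q eq Res (≡-sym y~u)))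

  merging-edge-fibres : ∀ x y → label merging-edge x ≡ label merging-edge y →
    label Q x ≡ label Q y ⊎ (label Q x ≡ label Q u × label Q y ≡ label Q v) ⊎ (label Q x ≡ label Q v × label Q y ≡ label Q u)
  merging-edge-fibres x y = merge-fibres (label Q x) (label Q y)

components : ∀ {n} (es : List (Fin n × Fin n)) → ∃ (Components es)
components []             = _ , no-edges
components ((u , v) ∷ es) with components es
... | zero  , Q = contradiction (label Q u) λ ()
... | suc k , Q with label Q v Fin.≟ label Q u
...   | yes v≡u = _ , redundant-edge Q (≡-sym v≡u)
...   | no  v≢u = _ , merging-edge Q v≢u

module Forest {n : ℕ}
  (Same        : Fin n × Fin n → Fin n → Fin n → Set)
  (Same-equiv  : ∀ e → IsEquivalence (Same e))
  where

  -- The abstract property of a set of cut edges: with `Same e` read as joined after deleting e,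
  -- each edge divides its own ends and keeps together the ends of every other edge.
  Separating : List (Fin n × Fin n) → Set
  Separating es = (∀ {u v} → (u , v) ∈ es → ¬ Same (u , v) u v)
    × (∀ {e x y} → e ∈ es → (x , y) ∈ es → e ≢ (x , y) → Same e x y)

  -- Each edge of es separates its ends from the point of view of Same, so it merges two components.
  forest : ∀ es → Unique es → Separating es → ∃ λ k → Σ (Components es k) λ Q → k + length es ≡ n ×
    (∀ x y → label Q x ≡ label Q y → (∀ e → e ∈ es → Same e x y) → x ≡ y)
  forest [] _ _ = n , no-edges , +-identityʳ n , λ x y x≡y _ → x≡y
  forest ((u , v) ∷ es) (e∉es ∷ unique) (separates , spares)
    with forest es unique ((separates ∘ there) , λ p q → spares (there p) (there q))
  ... | zero  , Q , _ , _ = contradiction (label Q u) λ ()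
  ... | suc k , Q , k+r≡n , injective = k , merging-edge Q v≢u , trans (+-suc k (length es)) k+r≡n , injective′
    where
    module S = IsEquivalence (Same-equiv (u , v))
    es-same : All (λ (x , y) → Same (u , v) x y) es
    es-same = All.tabulate λ p → spares (here refl) (there p) (All.lookup e∉es p)
    same : ∀ {x y} → label Q x ≡ label Q y → Same (u , v) x y
    same = label-minimal Q (Same-equiv (u , v)) es-same
    v≢u : label Q v ≢ label Q u
    v≢u v≡u = separates (here refl) (same (≡-sym v≡u))
    injective′ : ∀ x y → label (merging-edge Q v≢u) x ≡ label (merging-edge Q v≢u) y →
      (∀ e → e ∈ (u , v) ∷ es → Same e x y) → x ≡ y
    injective′ x y x~y all with merging-edge-fibres Q v≢u x y x~y
    ... | inj₁ eq = injective x y eq λ e p → all e (there p)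
    -- The new edge is what joins x to y, and the older edges place x with u and y with v. All of
    -- these survive its deletion, so `Same (u , v) x y` would put u and v together.
    ... | inj₂ (inj₁ (x~u , y~v)) = contradiction
      (S.trans (S.sym (same x~u)) (S.trans (all _ (here refl)) (same y~v))) (separates (here refl))
    ... | inj₂ (inj₂ (x~v , y~u)) = contradiction
      (S.trans (S.sym (same y~u)) (S.trans (S.sym (all _ (here refl))) (same x~v))) (separates (here refl))

-- Contracting the cut edges

open Components

does⇒ : ∀ {P : Set} (P? : Dec P) → does P? ≡ true → P
does⇒ (yes p) _ = p

does-false⇒ : ∀ {P : Set} (P? : Dec P) → does P? ≡ false → ¬ P
does-false⇒ (no ¬p) _ = ¬p

∧-true : ∀ {a b} → a ∧ b ≡ true → a ≡ true × b ≡ true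
∧-true {true} b≡true = refl , b≡true

==-refl : ∀ {n} (i : Fin n) → (i == i) ≡ true
==-refl i = Equivalence.to Bool.T-≡ (≡⇒≡ᵇ (toℕ i) (toℕ i) refl)

==⇒≡ : ∀ {n} (i j : Fin n) → (i == j) ≡ true → i ≡ j
==⇒≡ i j eq = Fin.toℕ-injective (≡ᵇ⇒≡ (toℕ i) (toℕ j) (Equivalence.from Bool.T-≡ eq))

==-≢ : ∀ {n} {i j : Fin n} → i ≢ j → (i == j) ≡ false
==-≢ i≢j = Bool.¬-not (i≢j ∘ ==⇒≡ _ _)

deleteEdge⁺ : ∀ {n} (A : Adj n) {u v x y} → A x y ≡ true →
  ¬ (x ≡ u × y ≡ v) → ¬ (x ≡ v × y ≡ u) → deleteEdge A u v x y ≡ true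
deleteEdge⁺ A {u} {v} {x} {y} Axy ≢uv ≢vu
  with x == u in xu | y == v in yv | x == v in xv | y == u in yu
... | true  | true  | _     | _     = contradiction (==⇒≡ x u xu , ==⇒≡ y v yv) ≢uv
... | true  | false | true  | true  = contradiction (==⇒≡ x v xv , ==⇒≡ y u yu) ≢vu
... | false | _     | true  | true  = contradiction (==⇒≡ x v xv , ==⇒≡ y u yu) ≢vu
... | true  | false | true  | false rewrite Axy = refl
... | true  | false | false | _     rewrite Axy = refl
... | false | _     | true  | false rewrite Axy = refl
... | false | _     | false | _     rewrite Axy = refl

deleteEdge⁻ : ∀ {n} (A : Adj n) {u v x y} → deleteEdge A u v x y ≡ true →
  A x y ≡ true × ¬ (x ≡ u × y ≡ v) × ¬ (x ≡ v × y ≡ u)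
deleteEdge⁻ A {u} {v} {x} {y} eq with A x y
... | true = refl , not-uv , not-vu
  where
  same : (x == x ∧ y == y) ≡ true
  same = cong₂ _∧_ (==-refl x) (==-refl y)
  not-uv : ¬ (x ≡ u × y ≡ v)
  not-uv (refl , refl) = contradiction (trans (≡-sym eq) (cong (λ b → not (b ∨ (x == y ∧ y == x))) same)) λ ()
  not-vu : ¬ (x ≡ v × y ≡ u)
  not-vu (refl , refl) = contradiction (trans (≡-sym eq) (cong not (trans (cong ((x == y ∧ y == x) ∨_) same) (Bool.∨-zeroʳ _)))) λ ()

deleteEdge-sym : ∀ {n} (A : Adj n) → (∀ i j → A i j ≡ A j i) →
  ∀ {u v} i j → deleteEdge A u v i j ≡ deleteEdge A u v j i
deleteEdge-sym A A-sym {u} {v} i j = cong₂ _∧_ (A-sym i j) (cong not (trans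
  (Bool.∨-comm (i == u ∧ j == v) (i == v ∧ j == u))
  (cong₂ _∨_ (Bool.∧-comm (i == v) (j == u)) (Bool.∧-comm (i == u) (j == v)))))

adjacentPairs : ∀ {n} → Adj n → List (Fin n × Fin n)
adjacentPairs {n} A = filter (λ (x , y) → A x y Bool.≟ true) (cartesianProduct (allFin n) (allFin n))

∈-adjacentPairs⁺ : ∀ {n} (A : Adj n) {x y} → A x y ≡ true → (x , y) ∈ adjacentPairs A
∈-adjacentPairs⁺ A {x} {y} = ∈-filter⁺ (λ (x , y) → A x y Bool.≟ true) (∈-cartesianProduct⁺ (∈-allFin x) (∈-allFin y))

adjacentPairs⁻ : ∀ {n} (A : Adj n) → All (λ (x , y) → A x y ≡ true) (adjacentPairs A)
adjacentPairs⁻ {n} A = All.tabulate λ p → proj₂ (∈-filter⁻ (λ (x , y) → A x y Bool.≟ true) {xs = cartesianProduct (allFin n) (allFin n)} p)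

component : ∀ {n} (A : Adj n) → Fin n → Fin (proj₁ (components (adjacentPairs A)))
component A = label (proj₂ (components (adjacentPairs A)))

adjacent⇒component : ∀ {n} (A : Adj n) {x y} → A x y ≡ true → component A x ≡ component A y
adjacent⇒component A Axy = All.lookup (label-edge (proj₂ (components (adjacentPairs A)))) (∈-adjacentPairs⁺ A Axy)

component⇒reach : ∀ {n} (A : Adj n) → (∀ i j → A i j ≡ A j i) → ∀ {x y} → component A x ≡ component A y → Reach A x y
component⇒reach A A-sym = label-minimal (proj₂ (components (adjacentPairs A))) (reach-isEquivalence A-sym)
  (All.map (λ e → step e here) (adjacentPairs⁻ A))

module _ {n : ℕ} (G : Graph n) where

  Side : Fin n × Fin n → Fin n → Fin n → Set
  Side (u , v) x y = component (deleteEdge (adj G) u v) x ≡ component (deleteEdge (adj G) u v) y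

  Side-isEquivalence : ∀ e → IsEquivalence (Side e)
  Side-isEquivalence (u , v) = kernel-isEquivalence (component (deleteEdge (adj G) u v))

  other-edge-side : ∀ {u v x y} → adj G x y ≡ true → ¬ (x ≡ u × y ≡ v) → ¬ (x ≡ v × y ≡ u) → Side (u , v) x y
  other-edge-side {u} {v} xy ≢uv ≢vu = adjacent⇒component (deleteEdge (adj G) u v) (deleteEdge⁺ (adj G) xy ≢uv ≢vu)

  -- If u and v kept the same label, every edge of G would join equal labels: uv by assumption, the
  -- others because they survive the deletion. Connectedness of G would then pass to the graph
  -- without uv.
  cut-edge-separates : Connected G → ∀ {u v} → IsCutEdge G (u , v) → ¬ Side (u , v) u v
  cut-edge-separates (0<n , conn) {u} {v} (_ , _ , disconnected) u~v = disconnected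
    (0<n , λ i j → component⇒reach (deleteEdge (adj G) u v) (deleteEdge-sym (adj G) (sym G))
      (reach-invariant (Side-isEquivalence (u , v)) edge-side (conn i j)))
    where
    edge-side : ∀ x y → adj G x y ≡ true → Side (u , v) x y
    edge-side x y xy with x Fin.≟ u | y Fin.≟ v | x Fin.≟ v | y Fin.≟ u
    ... | yes refl | yes refl | _ | _ = u~v
    ... | _ | _ | yes refl | yes refl = ≡-sym u~v
    ... | no x≢u | _ | no x≢v | _ = other-edge-side xy (x≢u ∘ proj₁) (x≢v ∘ proj₁)
    ... | no x≢u | _ | _ | no y≢u = other-edge-side xy (x≢u ∘ proj₁) (y≢u ∘ proj₂)
    ... | _ | no y≢v | no x≢v | _ = other-edge-side xy (y≢v ∘ proj₂) (x≢v ∘ proj₁)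
    ... | _ | no y≢v | _ | no y≢u = other-edge-side xy (y≢v ∘ proj₂) (y≢u ∘ proj₂)

-- A sum of products of deltas, so that the length of the list becomes a double sum over vertices;
-- the factor 1 gives the shape required by `sum-delta`.
occurrences : ∀ {n} → List (Fin n × Fin n) → Fin n → Fin n → ℕ
occurrences []             i j = 0
occurrences ((u , v) ∷ es) i j = ⟦ does (u Fin.≟ i) ⟧ * (⟦ does (v Fin.≟ j) ⟧ * 1) + occurrences es i j

sum-occurrences : ∀ {n} (es : List (Fin n × Fin n)) → ∑[ i < n ] ∑[ j < n ] occurrences es i j ≡ length es
sum-occurrences {n} [] = sum-zero {n} (λ _ → sum-zero {n} (λ _ → refl))
sum-occurrences {n} ((u , v) ∷ es) = begin
  ∑[ i < n ] ∑[ j < n ] (d u i * (d v j * 1) + occurrences es i j)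
    ≡⟨ sum-cong-≗ (λ i → ∑-distrib-+ (λ j → d u i * (d v j * 1)) (occurrences es i)) ⟩
  ∑[ i < n ] (∑[ j < n ] (d u i * (d v j * 1)) + ∑[ j < n ] occurrences es i j)
    ≡⟨ ∑-distrib-+ (λ i → ∑[ j < n ] (d u i * (d v j * 1))) (λ i → ∑[ j < n ] occurrences es i j) ⟩
  ∑[ i < n ] ∑[ j < n ] (d u i * (d v j * 1)) + ∑[ i < n ] ∑[ j < n ] occurrences es i j
    ≡⟨ cong₂ _+_ (sum-cong-≗ (λ i → ≡-sym (*-distribˡ-sum (d u i) (λ j → d v j * 1)))) (sum-occurrences es) ⟩
  ∑[ i < n ] (d u i * ∑[ j < n ] (d v j * 1)) + length es
    ≡⟨ cong (_+ length es) (sum-delta (λ i → ∑[ j < n ] (d v j * 1)) u) ⟩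
  ∑[ j < n ] (d v j * 1) + length es
    ≡⟨ cong (_+ length es) (sum-delta (λ _ → 1) v) ⟩
  suc (length es) ∎
  where
  open ≡-Reasoning
  d : Fin n → Fin n → ℕ
  d a b = ⟦ does (a Fin.≟ b) ⟧

∉⇒occurrences≡0 : ∀ {n} (es : List (Fin n × Fin n)) {i j} → (i , j) ∉ es → occurrences es i j ≡ 0
∉⇒occurrences≡0 []             _  = refl
∉⇒occurrences≡0 ((u , v) ∷ es) {i} {j} ∉ with u Fin.≟ i | v Fin.≟ j
... | yes refl | yes refl = contradiction (here refl) ∉
... | yes _    | no _     = ∉⇒occurrences≡0 es (∉ ∘ there)
... | no _     | _        = ∉⇒occurrences≡0 es (∉ ∘ there)

∈⇒occurrences≡1 : ∀ {n} {es : List (Fin n × Fin n)} → Unique es → ∀ {i j} → (i , j) ∈ es → occurrences es i j ≡ 1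
∈⇒occurrences≡1 {es = (u , v) ∷ es} (e≢ ∷ unique) {i} {j} p with u Fin.≟ i | v Fin.≟ j | p
... | yes refl | yes refl | _         = cong suc (∉⇒occurrences≡0 es λ q → All.lookup e≢ q refl)
... | no u≢i   | _        | here refl = contradiction refl u≢i
... | yes _    | no v≢j   | here refl = contradiction refl v≢j
... | yes _    | no _     | there q   = ∈⇒occurrences≡1 unique q
... | no _     | _        | there q   = ∈⇒occurrences≡1 unique q

-- For a labelling ρ of the components of the cut edges, the cut edges are
-- the edges inside a fibre of ρ.
module Split {n m : ℕ} (G : Graph n) (ρ : Fin n → Fin m) where

  cut nonCut : Fin n → Fin n → Bool
  cut    i j = adj G i j ∧ does (ρ i Fin.≟ ρ j)
  nonCut i j = adj G i j ∧ not (does (ρ i Fin.≟ ρ j))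

  cutDegree nonCutDegree : Fin n → ℕ
  cutDegree    i = ∑[ j < n ] ⟦ cut i j ⟧
  nonCutDegree i = ∑[ j < n ] ⟦ nonCut i j ⟧

  cut⁻ : ∀ {i j} → cut i j ≡ true → adj G i j ≡ true × ρ i ≡ ρ j
  cut⁻ {i} {j} eq with ∧-true eq
  ... | ij , ρ≡ = ij , does⇒ (ρ i Fin.≟ ρ j) ρ≡

  cut⁺ : ∀ {i j} → adj G i j ≡ true → ρ i ≡ ρ j → cut i j ≡ true
  cut⁺ {i} {j} ij ρ≡ = cong₂ _∧_ ij (dec-true (ρ i Fin.≟ ρ j) ρ≡)

  nonCut⁻ : ∀ {i j} → nonCut i j ≡ true → adj G i j ≡ true × ρ i ≢ ρ j
  nonCut⁻ {i} {j} eq with ∧-true eq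
  ... | ij , ρ≢ = ij , does-false⇒ (ρ i Fin.≟ ρ j) (trans (≡-sym (Bool.not-involutive _)) (cong not ρ≢))

  nonCut⁺ : ∀ {i j} → adj G i j ≡ true → ρ i ≢ ρ j → nonCut i j ≡ true
  nonCut⁺ {i} {j} ij ρ≢ = cong₂ _∧_ ij (cong not (dec-false (ρ i Fin.≟ ρ j) ρ≢))

-- The interface between graph theory and counting: all later bounds on `cut` and `nonCut` come from
-- these fields. `order` says that a forest with r edges on n vertices has n - r trees, and
-- `sum-cut` counts each cut edge from both ends.
record CutStructure {n : ℕ} (G : Graph n) (r t : ℕ) : Set where
  field
    ρ             : Fin n → Fin (suc t)
    order         : suc t + r ≡ n
    sum-cut       : ∑[ i < n ] Split.cutDegree G ρ i ≡ r + r
    nonCut-unique : ∀ {u x u′ x′} → Split.nonCut G ρ u x ≡ true → Split.nonCut G ρ u′ x′ ≡ true →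
      ρ u ≡ ρ u′ → ρ x ≡ ρ x′ → u ≡ u′ × x ≡ x′
    t≢1           : t ≢ 1
  open Split G ρ public

module _ {n r : ℕ} (G : Graph n) (conn : Connected G) (hasCut : HasCutEdges G r) where
  private
    es : List (Fin n × Fin n)
    es = proj₁ hasCut
    unique : Unique es
    unique = proj₁ (proj₂ (proj₂ hasCut))
    isCut : ∀ {e} → e ∈ es → IsCutEdge G e
    isCut = All.lookup (proj₁ (proj₂ (proj₂ (proj₂ hasCut))))
    allCut : ∀ e → IsCutEdge G e → e ∈ es
    allCut = proj₂ (proj₂ (proj₂ (proj₂ hasCut)))

    not-reversed : ∀ {u v x y : Fin n} → (u , v) ∈ es → (x , y) ∈ es → ¬ (x ≡ v × y ≡ u)
    not-reversed p q (refl , refl) = <-asym (proj₁ (isCut p)) (proj₁ (isCut q))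

    irreflexive : ∀ {x} → adj G x x ≢ true
    irreflexive {x} xx with () ← trans (≡-sym xx) (irrefl G x)

    cutEdges-spare : ∀ {e x y} → e ∈ es → (x , y) ∈ es → e ≢ (x , y) → Side G e x y
    cutEdges-spare {u , v} p q e≢ = other-edge-side G (proj₁ (proj₂ (isCut q)))
      (λ (x≡u , y≡v) → e≢ (cong₂ _,_ (≡-sym x≡u) (≡-sym y≡v))) (not-reversed p q)

    module WithForest (t : ℕ) (Q : Components es (suc t))
      (injective : ∀ x y → label Q x ≡ label Q y → (∀ e → e ∈ es → Side G e x y) → x ≡ y) where

      ρ : Fin n → Fin (suc t)
      ρ = label Q
      open Split G ρ

      nonCut-side : ∀ {x y} → nonCut x y ≡ true → ∀ e → e ∈ es → Side G e x y
      nonCut-side nc (u , v) p with nonCut⁻ nc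
      ... | xy , ρx≢ρy = other-edge-side G xy
        (λ { (refl , refl) → ρx≢ρy (All.lookup (label-edge Q) p) })
        (λ { (refl , refl) → ρx≢ρy (≡-sym (All.lookup (label-edge Q) p)) })

      open import Data.List.Membership.DecPropositional (Product.≡-dec (Fin._≟_ {n}) (Fin._≟_ {n})) using (_∈?_)

      -- An edge that is not in `es` survives the deletion of any cut edge, so no cut edge separates
      -- its ends. Two such ends in one class must coincide by `injective`, which would be a loop.
      cut⇒∈ : ∀ {x y} → cut x y ≡ true → (x , y) ∈ es ⊎ (y , x) ∈ es
      cut⇒∈ {x} {y} c with cut⁻ c | (x , y) ∈? es | (y , x) ∈? es
      ... | _        | yes p | _     = inj₁ p
      ... | _        | no _  | yes q = inj₂ q
      ... | xy , ρ≡ | no ∉  | no ∉′ = contradiction xy (subst (λ z → adj G x z ≢ true) (injective x y ρ≡ side) irreflexive)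
        where
        side : ∀ e → e ∈ es → Side G e x y
        side (u , v) p = other-edge-side G xy (λ { (refl , refl) → ∉ p }) (λ { (refl , refl) → ∉′ p })

      ∈⇒cut : ∀ {x y} → (x , y) ∈ es → cut x y ≡ true
      ∈⇒cut p = cut⁺ (proj₁ (proj₂ (isCut p))) (All.lookup (label-edge Q) p)

      cut-sym : ∀ x y → cut x y ≡ true → cut y x ≡ true
      cut-sym x y c with cut⁻ c
      ... | xy , ρ≡ = cut⁺ (trans (sym G y x) xy) (≡-sym ρ≡)

      cut-occurrences : ∀ i j → ⟦ cut i j ⟧ ≡ occurrences es i j + occurrences es j i
      cut-occurrences i j with (i , j) ∈? es | (j , i) ∈? es | cut i j in eq
      ... | yes p | yes q | _ = contradiction (refl , refl) (not-reversed p q)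
      ... | yes p | no  q | true = ≡-sym (cong₂ _+_ (∈⇒occurrences≡1 unique p) (∉⇒occurrences≡0 es q))
      ... | no  p | yes q | true = ≡-sym (cong₂ _+_ (∉⇒occurrences≡0 es p) (∈⇒occurrences≡1 unique q))
      ... | no  p | no  q | false = ≡-sym (cong₂ _+_ (∉⇒occurrences≡0 es p) (∉⇒occurrences≡0 es q))
      ... | yes p | no  q | false = contradiction (trans (≡-sym (∈⇒cut p)) eq) λ ()
      ... | no  p | yes q | false = contradiction (trans (≡-sym (cut-sym j i (∈⇒cut q))) eq) λ ()
      ... | no  p | no  q | true = Sum.[ (λ p′ → contradiction p′ p) , (λ q′ → contradiction q′ q) ] (cut⇒∈ eq)

      sum-cut : ∑[ i < n ] cutDegree i ≡ r + r
      sum-cut = begin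
        ∑[ i < n ] ∑[ j < n ] ⟦ cut i j ⟧
          ≡⟨ sum-cong-≗ (λ i → trans (sum-cong-≗ (cut-occurrences i)) (∑-distrib-+ (occ i) (λ j → occ j i))) ⟩
        ∑[ i < n ] (∑[ j < n ] occ i j + ∑[ j < n ] occ j i)
          ≡⟨ ∑-distrib-+ (λ i → ∑[ j < n ] occ i j) (λ i → ∑[ j < n ] occ j i) ⟩
        ∑[ i < n ] ∑[ j < n ] occ i j + ∑[ i < n ] ∑[ j < n ] occ j i
          ≡⟨ cong (∑[ i < n ] ∑[ j < n ] occ i j +_) (∑-comm (λ i j → occ j i)) ⟩
        ∑[ i < n ] ∑[ j < n ] occ i j + ∑[ i < n ] ∑[ j < n ] occ i j
          ≡⟨ cong₂ _+_ total total ⟩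
        r + r ∎
        where
        open ≡-Reasoning
        occ : Fin n → Fin n → ℕ
        occ = occurrences es
        total : ∑[ i < n ] ∑[ j < n ] occ i j ≡ r
        total = trans (sum-occurrences es) (proj₁ (proj₂ hasCut))

      -- Two non-cut edges between the same components P ≠ P′ would close a cycle through
      -- cut edges of P or of P′, unless they coincide.
      nonCut-unique : ∀ {u x u′ x′} → nonCut u x ≡ true → nonCut u′ x′ ≡ true →
        ρ u ≡ ρ u′ → ρ x ≡ ρ x′ → u ≡ u′ × x ≡ x′
      nonCut-unique {u} {x} {u′} {x′} nc nc′ u~u′ x~x′ =
        injective u u′ u~u′ u-side , injective x x′ x~x′ λ e p → S.trans e (S.sym e (nonCut-side nc e p)) (S.trans e (u-side e p) (nonCut-side nc′ e p))
        where
        module S e = IsEquivalence (Side-isEquivalence G e)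
        -- Inside a component that avoids the cut edge e, nothing is separated by e.
        avoids : ∀ {e} → e ∈ es → ∀ {y z} → ρ (proj₁ e) ≢ ρ y → ρ y ≡ ρ z → Side G e y z
        avoids {e} p {y} {z} e∉y y~z = proj₂ (label-minimal Q restricted (All.tabulate spare) y~z) refl
          where
          -- `label-minimal` needs a relation on all vertices. This one demands the same side of e
          -- only inside the class of y; requiring equal classes as well makes it transitive. The
          -- edge e satisfies it vacuously, since it lies in another class.
          restricted : IsEquivalence (λ a b → ρ a ≡ ρ b × (ρ a ≡ ρ y → Side G e a b))
          restricted = record
            { refl  = refl , λ _ → S.refl e
            ; sym   = λ (ab , s) → ≡-sym ab , λ by → S.sym e (s (trans ab by))
            ; trans = λ (ab , s) (bc , s′) → trans ab bc , λ ay → S.trans e (s ay) (s′ (trans (≡-sym ab) ay))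
            }
          spare : ∀ {f} → f ∈ es → ρ (proj₁ f) ≡ ρ (proj₂ f) × (ρ (proj₁ f) ≡ ρ y → Side G e (proj₁ f) (proj₂ f))
          spare q = All.lookup (label-edge Q) q , λ f∈y → cutEdges-spare p q λ { refl → e∉y f∈y }
        u-side : ∀ e → e ∈ es → Side G e u u′
        u-side e p with ρ (proj₁ e) Fin.≟ ρ u
        ... | no  e∉u = avoids p e∉u u~u′
        -- Now e lies in the class of u, so the detour u, x, x′, u′ avoids it: its two outer edges
        -- are non-cut, and its middle part stays in the class of x.
        ... | yes e∈u = S.trans e (nonCut-side nc e p) (S.trans e
          (avoids p (λ e∈x → proj₂ (nonCut⁻ nc) (trans (≡-sym e∈u) e∈x)) x~x′)
          (S.sym e (nonCut-side nc′ e p)))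

    -- By `nonCut-unique` at most one edge joins the two classes. Deleting it would disconnect G, so
    -- it would be listed in `es` and lie inside a class. Hence no edge joins the classes, contrary
    -- to connectedness.
    module TwoComponents (Q : Components es 2)
      (injective : ∀ x y → label Q x ≡ label Q y → (∀ e → e ∈ es → Side G e x y) → x ≡ y) where
      open WithForest 1 Q injective
      open Split G ρ

      separated⇒∈ : ∀ {x y} → toℕ x < toℕ y → nonCut x y ≡ true → (x , y) ∈ es
      separated⇒∈ {x} {y} x<y nc = allCut (x , y) (x<y , proj₁ (nonCut⁻ nc) , λ (_ , conn′) →
        proj₂ (nonCut⁻ nc) (reach-invariant (kernel-isEquivalence ρ) preserved (conn′ x y)))
        where
        other : ∀ {a b c : Fin 2} → a ≢ b → a ≢ c → b ≡ c
        other {zero}     {zero}     a≢b a≢c = contradiction refl a≢b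
        other {zero}     {suc zero} {zero}     a≢b a≢c = contradiction refl a≢c
        other {zero}     {suc zero} {suc zero} a≢b a≢c = refl
        other {suc zero} {suc zero} a≢b a≢c = contradiction refl a≢b
        other {suc zero} {zero} {suc zero} a≢b a≢c = contradiction refl a≢c
        other {suc zero} {zero} {zero} a≢b a≢c = refl
        preserved : ∀ a b → deleteEdge (adj G) x y a b ≡ true → ρ a ≡ ρ b
        preserved a b ab with deleteEdge⁻ (adj G) {x} {y} ab | ρ a Fin.≟ ρ b
        ... | _ | yes ρ≡ = ρ≡
        ... | ab′ , ≢xy , ≢yx | no ρa≢ρb with ρ x Fin.≟ ρ a
        ...   | yes x~a = contradiction
          (nonCut-unique (nonCut⁺ ab′ ρa≢ρb) nc (≡-sym x~a) (other ρa≢ρb (λ a~y → proj₂ (nonCut⁻ nc) (trans x~a a~y)))) ≢xy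
        ...   | no x≁a = contradiction
          (nonCut-unique (nonCut⁺ ab′ ρa≢ρb) (nonCut⁺ (trans (sym G y x) (proj₁ (nonCut⁻ nc))) (proj₂ (nonCut⁻ nc) ∘ ≡-sym)) a~y (other ρa≢ρb (x≁a ∘ ≡-sym))) ≢yx
          where
          a~y : ρ a ≡ ρ y
          a~y = other x≁a (proj₂ (nonCut⁻ nc))

      edge-label : ∀ x y → adj G x y ≡ true → ρ x ≡ ρ y
      edge-label x y xy with ρ x Fin.≟ ρ y | <-cmp (toℕ x) (toℕ y)
      ... | yes ρ≡ | _ = ρ≡
      ... | no ρ≢  | tri< x<y _ _ = All.lookup (label-edge Q) (separated⇒∈ x<y (nonCut⁺ xy ρ≢))
      ... | no ρ≢  | tri≈ _ x≡y _ = cong ρ (Fin.toℕ-injective x≡y)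
      ... | no ρ≢  | tri> _ _ y<x = ≡-sym (All.lookup (label-edge Q) (separated⇒∈ y<x (nonCut⁺ (trans (sym G y x) xy) (ρ≢ ∘ ≡-sym))))

      impossible : ⊥
      impossible with () ← trans (≡-sym (label-representative Q zero))
        (trans (reach-invariant (kernel-isEquivalence ρ) edge-label (proj₂ conn (representative Q zero) (representative Q (suc zero))))
          (label-representative Q (suc zero)))

  cutStructure : ∃ (CutStructure G r)
  cutStructure with Forest.forest (Side G) (Side-isEquivalence G) es unique
    ((λ p → cut-edge-separates G conn (isCut p)) , cutEdges-spare)
  ... | zero , Q , _ , _ = contradiction (label Q (Fin.fromℕ< (proj₁ conn))) λ ()
  ... | suc t , Q , order , injective = t , record
    { ρ             = ρ
    ; order         = trans (cong (suc t +_) (≡-sym (proj₁ (proj₂ hasCut)))) order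
    ; sum-cut       = sum-cut
    ; nonCut-unique = nonCut-unique
    ; t≢1           = λ { refl → TwoComponents.impossible Q injective }
    }
    where open WithForest t Q injective

-- Degree bounds

length-filter-tabulate : ∀ {A : Set} {n} (p : A → Bool) (f : Fin n → A) →
  length (filterᵇ p (tabulate f)) ≡ ∑[ i < n ] ⟦ p (f i) ⟧
length-filter-tabulate {n = zero}  p f = refl
length-filter-tabulate {n = suc n} p f with p (f zero)
... | true  = cong suc (length-filter-tabulate p (f ∘ suc))
... | false = length-filter-tabulate p (f ∘ suc)

degree≡sum : ∀ {n} (G : Graph n) i → degree G i ≡ ∑[ j < n ] ⟦ adj G i j ⟧
degree≡sum G i = length-filter-tabulate (adj G i) id

sum-concatMap-tabulate : ∀ {A B : Set} {n} (g : B → ℕ) (h : A → List B) (f : Fin n → A) →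
  List.sum (map g (concatMap h (tabulate f))) ≡ ∑[ i < n ] List.sum (map g (h (f i)))
sum-concatMap-tabulate {n = zero}  g h f = refl
sum-concatMap-tabulate {n = suc n} g h f = begin
  List.sum (map g (h (f zero) ++ concatMap h (tabulate (f ∘ suc))))
    ≡⟨ cong List.sum (List.map-++ g (h (f zero)) _) ⟩
  List.sum (map g (h (f zero)) ++ map g (concatMap h (tabulate (f ∘ suc))))
    ≡⟨ List.sum-++ (map g (h (f zero))) _ ⟩
  List.sum (map g (h (f zero))) + List.sum (map g (concatMap h (tabulate (f ∘ suc))))
    ≡⟨ cong (List.sum (map g (h (f zero))) +_) (sum-concatMap-tabulate g h (f ∘ suc)) ⟩
  List.sum (map g (h (f zero))) + ∑[ i < n ] List.sum (map g (h (f (suc i)))) ∎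
  where open ≡-Reasoning

sum-edges : ∀ {n} (G : Graph n) (f : Fin n × Fin n → ℕ) →
  List.sum (map f (edges G)) ≡ ∑[ i < n ] ∑[ j < n ] (⟦ (toℕ i <ᵇ toℕ j) ∧ adj G i j ⟧ * f (i , j))
sum-edges {n} G f = trans
  (sum-concatMap-tabulate f row id)
  (sum-cong-≗ λ i → trans (sum-concatMap-tabulate f (cell i) id) (sum-cong-≗ (cell-sum i)))
  where
  cell : Fin n → Fin n → List (Fin n × Fin n)
  cell i j = if (toℕ i <ᵇ toℕ j) ∧ adj G i j then (i , j) ∷ [] else []
  row : Fin n → List (Fin n × Fin n)
  row i = concatMap (cell i) (allFin n)
  cell-sum : ∀ i j → List.sum (map f (cell i j)) ≡ ⟦ (toℕ i <ᵇ toℕ j) ∧ adj G i j ⟧ * f (i , j)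
  cell-sum i j with (toℕ i <ᵇ toℕ j) ∧ adj G i j
  ... | true  = refl
  ... | false = refl

-- Passes from edges listed with increasing ends to ordered pairs, where sums can be exchanged and
-- the symmetry of f used freely.
double-sum-edges : ∀ {n} (G : Graph n) (f : Fin n → Fin n → ℕ) → (∀ i j → f i j ≡ f j i) →
  2 * List.sum (map (λ (i , j) → f i j) (edges G)) ≡ ∑[ i < n ] ∑[ j < n ] (⟦ adj G i j ⟧ * f i j)
double-sum-edges {n} G f f-sym = begin
  2 * List.sum (map (λ (i , j) → f i j) (edges G))   ≡⟨ cong (2 *_) (sum-edges G (λ (i , j) → f i j)) ⟩
  X + (X + 0)                                        ≡⟨ cong (X +_) (trans (+-identityʳ X) (∑-comm g)) ⟩
  X + ∑[ i < n ] ∑[ j < n ] g j i                    ≡⟨ ∑-distrib-+ (λ i → ∑[ j < n ] g i j) (λ i → ∑[ j < n ] g j i) ⟨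
  ∑[ i < n ] (∑[ j < n ] g i j + ∑[ j < n ] g j i)   ≡⟨ sum-cong-≗ (λ i → trans (≡-sym (∑-distrib-+ (g i) (λ j → g j i))) (sum-cong-≗ (both i))) ⟩
  ∑[ i < n ] ∑[ j < n ] (⟦ adj G i j ⟧ * f i j)      ∎
  where
  open ≡-Reasoning
  g : Fin n → Fin n → ℕ
  g i j = ⟦ (toℕ i <ᵇ toℕ j) ∧ adj G i j ⟧ * f i j
  X : ℕ
  X = ∑[ i < n ] ∑[ j < n ] g i j
  <ᵇ-true : ∀ {a b} → a < b → (a <ᵇ b) ≡ true
  <ᵇ-true a<b = Equivalence.to Bool.T-≡ (<⇒<ᵇ a<b)
  <ᵇ-false : ∀ {a b} → ¬ a < b → (a <ᵇ b) ≡ false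
  <ᵇ-false {a} {b} a≮b = Bool.¬-not λ eq → a≮b (<ᵇ⇒< a b (Equivalence.from Bool.T-≡ eq))
  both : ∀ i j → g i j + g j i ≡ ⟦ adj G i j ⟧ * f i j
  both i j with <-cmp (toℕ i) (toℕ j)
  ... | tri< i<j _ i≯j rewrite <ᵇ-true i<j | <ᵇ-false i≯j = +-identityʳ _
  ... | tri> i≮j _ i>j rewrite <ᵇ-true i>j | <ᵇ-false i≮j | sym G j i | f-sym j i = refl
  ... | tri≈ i≮j i≡j i≯j with Fin.toℕ-injective i≡j
  ...   | refl rewrite <ᵇ-false i≮j | irrefl G i = refl

weighted-handshake : ∀ {n} (p : Fin n → Fin n → Bool) → (∀ i j → p i j ≡ p j i) → (f : Fin n → ℕ) →
  ∑[ i < n ] ∑[ j < n ] (⟦ p i j ⟧ * (f i + f j)) ≡ 2 * ∑[ i < n ] (f i * ∑[ j < n ] ⟦ p i j ⟧)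
weighted-handshake {n} p p-sym f = begin
  ∑[ i < n ] ∑[ j < n ] (⟦ p i j ⟧ * (f i + f j))
    ≡⟨ sum-cong-≗ (λ i → trans (sum-cong-≗ (λ j → distribute (⟦ p i j ⟧) (f i) (f j)))
         (∑-distrib-+ (λ j → f i * ⟦ p i j ⟧) (λ j → f j * ⟦ p i j ⟧))) ⟩
  ∑[ i < n ] (∑[ j < n ] (f i * ⟦ p i j ⟧) + ∑[ j < n ] (f j * ⟦ p i j ⟧))
    ≡⟨ ∑-distrib-+ (λ i → ∑[ j < n ] (f i * ⟦ p i j ⟧)) (λ i → ∑[ j < n ] (f j * ⟦ p i j ⟧)) ⟩
  X + ∑[ i < n ] ∑[ j < n ] (f j * ⟦ p i j ⟧)
    ≡⟨ cong (X +_) (∑-comm (λ i j → f j * ⟦ p i j ⟧)) ⟩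
  X + ∑[ j < n ] ∑[ i < n ] (f j * ⟦ p i j ⟧)
    ≡⟨ cong (X +_) (sum-cong-≗ λ j → sum-cong-≗ λ i → cong (λ b → f j * ⟦ b ⟧) (p-sym i j)) ⟩
  X + X
    ≡⟨ cong (X +_) (+-identityʳ X) ⟨
  2 * X
    ≡⟨ cong (2 *_) (sum-cong-≗ λ i → ≡-sym (*-distribˡ-sum (f i) (λ j → ⟦ p i j ⟧))) ⟩
  2 * ∑[ i < n ] (f i * ∑[ j < n ] ⟦ p i j ⟧) ∎
  where
  open ≡-Reasoning
  X : ℕ
  X = ∑[ i < n ] ∑[ j < n ] (f i * ⟦ p i j ⟧)
  distribute : ∀ b x y → b * (x + y) ≡ x * b + y * b
  distribute = solve-∀

-- The total gap between g and f is at least the gaps at i and j; both sides are rearranged so that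
-- no subtraction occurs.
two-excesses≤sum : ∀ {n} {f g : Fin n → ℕ} → (∀ i → f i ≤ g i) → ∀ {i j} → i ≢ j →
  sum f + (g i + g j) ≤ sum g + (f i + f j)
two-excesses≤sum {n} {f} {g} f≤g {i} {j} i≢j = begin
  sum f + (g i + g j)                    ≡⟨ cong (sum f +_) (cong₂ _+_ (g≡f+h i) (g≡f+h j)) ⟩
  sum f + (f i + h i + (f j + h j))      ≡⟨ shuffle (sum f) (f i) (h i) (f j) (h j) ⟩
  sum f + (h i + h j) + (f i + f j)      ≤⟨ +-monoˡ-≤ (f i + f j) (+-monoʳ-≤ (sum f) (two-terms≤sum h i≢j)) ⟩
  sum f + sum h + (f i + f j)            ≡⟨ cong (_+ (f i + f j)) (∑-distrib-+ f h) ⟨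
  ∑[ i < n ] (f i + h i) + (f i + f j)   ≡⟨ cong (_+ (f i + f j)) (sum-cong-≗ g≡f+h) ⟨
  sum g + (f i + f j)                    ∎
  where
  open ≤-Reasoning
  h : Fin n → ℕ
  h i = g i ∸ f i
  g≡f+h : ∀ i → g i ≡ f i + h i
  g≡f+h i = ≡-sym (m+[n∸m]≡n (f≤g i))
  shuffle : ∀ s a b c d → s + (a + b + (c + d)) ≡ s + (b + d) + (a + c)
  shuffle = solve-∀

excess≤sum : ∀ {n} {f g : Fin n → ℕ} → (∀ i → f i ≤ g i) → ∀ i → sum f + g i ≤ sum g + f i
excess≤sum {suc n} {f} {g} f≤g zero    = begin
  f zero + sum (f ∘ suc) + g zero    ≡⟨ shuffle (f zero) _ (g zero) ⟩
  g zero + sum (f ∘ suc) + f zero    ≤⟨ +-monoˡ-≤ (f zero) (+-monoʳ-≤ (g zero) (sum-mono (f≤g ∘ suc))) ⟩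
  g zero + sum (g ∘ suc) + f zero    ∎
  where
  open ≤-Reasoning
  shuffle : ∀ a b c → a + b + c ≡ c + b + a
  shuffle = solve-∀
excess≤sum {suc n} {f} {g} f≤g (suc i) = begin
  f zero + sum (f ∘ suc) + g (suc i)   ≡⟨ +-assoc (f zero) _ _ ⟩
  f zero + (sum (f ∘ suc) + g (suc i)) ≤⟨ +-mono-≤ (f≤g zero) (excess≤sum (f≤g ∘ suc) i) ⟩
  g zero + (sum (g ∘ suc) + f (suc i)) ≡⟨ +-assoc (g zero) _ _ ⟨
  g zero + sum (g ∘ suc) + f (suc i)   ∎
  where open ≤-Reasoning

double-sum≤1 : ∀ {n} (f : Fin n → Fin n → ℕ) → (∀ i j → f i j ≤ 1) →
  (∀ {i j i′ j′} → 0 < f i j → 0 < f i′ j′ → i ≡ i′ × j ≡ j′) → ∑[ i < n ] ∑[ j < n ] f i j ≤ 1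
double-sum≤1 f f≤1 unique = sum≤1 (λ i → sum (f i))
  (λ i → sum≤1 (f i) (f≤1 i) λ j j′ p q → proj₂ (unique p q))
  (λ i i′ p q → proj₁ (unique (proj₂ (sum-positive (f i) p)) (proj₂ (sum-positive (f i′) q))))

0<*ˡ : ∀ {a b} → 0 < a * b → 0 < a
0<*ˡ {suc a} _ = s≤s z≤n

0<*ʳ : ∀ {a b} → 0 < a * b → 0 < b
0<*ʳ {a} {suc b} _  = s≤s z≤n
0<*ʳ {a} {zero}  ab = contradiction ab (subst (λ x → ¬ 0 < x) (≡-sym (*-zeroʳ a)) λ ())

module Bounds {n r t : ℕ} {G : Graph n} (S : CutStructure G r t) where
  open CutStructure S

  adj-split : ∀ i j → ⟦ adj G i j ⟧ ≡ ⟦ cut i j ⟧ + ⟦ nonCut i j ⟧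
  adj-split i j with adj G i j | does (ρ i Fin.≟ ρ j)
  ... | true  | true  = refl
  ... | true  | false = refl
  ... | false | _     = refl

  does-≟-sym : ∀ {m} (a b : Fin m) → does (a Fin.≟ b) ≡ does (b Fin.≟ a)
  does-≟-sym a b with a Fin.≟ b
  ... | yes a≡b = ≡-sym (dec-true (b Fin.≟ a) (≡-sym a≡b))
  ... | no a≢b  = ≡-sym (dec-false (b Fin.≟ a) (a≢b ∘ ≡-sym))

  cut-sym : ∀ i j → cut i j ≡ cut j i
  cut-sym i j = cong₂ _∧_ (sym G i j) (does-≟-sym (ρ i) (ρ j))

  nonCut-sym : ∀ i j → nonCut i j ≡ nonCut j i
  nonCut-sym i j = cong₂ (λ a b → a ∧ not b) (sym G i j) (does-≟-sym (ρ i) (ρ j))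

  cut-irrefl : ∀ i → cut i i ≡ false
  cut-irrefl i = cong (_∧ does (ρ i Fin.≟ ρ i)) (irrefl G i)

  degree-split : ∀ i → degree G i ≡ cutDegree i + nonCutDegree i
  degree-split i = trans (degree≡sum G i) (trans (sum-cong-≗ (adj-split i)) (∑-distrib-+ (λ j → ⟦ cut i j ⟧) (λ j → ⟦ nonCut i j ⟧)))

  classDegree : Fin (suc t) → ℕ
  classDegree a = ∑[ u < n ] (⟦ does (ρ u Fin.≟ a) ⟧ * nonCutDegree u)

  -- Each of the other t classes receives at most one non-cut edge from the class a, by
  -- `nonCut-unique`. The added 1 accounts for the class a itself, which receives none.
  classDegree≤t : ∀ a → classDegree a ≤ t
  classDegree≤t a = +-cancelʳ-≤ 1 _ _ (begin
    classDegree a + 1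
      ≡⟨ cong (_+ 1) (sum-cong-≗ λ u → trans (*-distribˡ-sum (i u) (λ x → ⟦ nonCut u x ⟧)) (sum-fibre ρ (λ x → i u * ⟦ nonCut u x ⟧))) ⟩
    ∑[ u < n ] ∑[ b < suc t ] ∑[ x < n ] edge b u x + 1
      ≡⟨ cong (_+ 1) (∑-comm (λ u b → ∑[ x < n ] edge b u x)) ⟩
    ∑[ b < suc t ] ∑[ u < n ] ∑[ x < n ] edge b u x + 1
      ≤⟨ +-monoˡ-≤ 1 (sum-mono edges≤) ⟩
    ∑[ b < suc t ] (⟦ not (does (a Fin.≟ b)) ⟧ * 1) + 1
      ≡⟨ sum-without {suc t} (λ _ → 1) a ⟩
    ∑[ b < suc t ] 1
      ≡⟨ trans (sum-const (suc t) 1) (trans (*-identityʳ (suc t)) (+-comm 1 t)) ⟩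
    t + 1 ∎)
    where
    open ≤-Reasoning
    i : Fin n → ℕ
    i u = ⟦ does (ρ u Fin.≟ a) ⟧
    edge : Fin (suc t) → Fin n → Fin n → ℕ
    edge b u x = ⟦ does (ρ x Fin.≟ b) ⟧ * (i u * ⟦ nonCut u x ⟧)
    edge≤1 : ∀ b u x → edge b u x ≤ 1
    edge≤1 b u x = *-mono-≤ (⟦⟧≤1 (does (ρ x Fin.≟ b))) (*-mono-≤ (⟦⟧≤1 (does (ρ u Fin.≟ a))) (⟦⟧≤1 (nonCut u x)))
    edge-ends : ∀ {b u x} → 0 < edge b u x → ρ u ≡ a × ρ x ≡ b × nonCut u x ≡ true
    edge-ends {b} {u} {x} pos =
      does⇒ (ρ u Fin.≟ a) (0<⟦⟧ (0<*ˡ (0<*ʳ {⟦ does (ρ x Fin.≟ b) ⟧} pos))) ,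
      does⇒ (ρ x Fin.≟ b) (0<⟦⟧ (0<*ˡ pos)) ,
      0<⟦⟧ (0<*ʳ {i u} (0<*ʳ {⟦ does (ρ x Fin.≟ b) ⟧} pos))
    edge-unique : ∀ {b u x u′ x′} → 0 < edge b u x → 0 < edge b u′ x′ → u ≡ u′ × x ≡ x′
    edge-unique p q with edge-ends p | edge-ends q
    ... | ρu , ρx , ux | ρu′ , ρx′ , ux′ = nonCut-unique ux ux′ (trans ρu (≡-sym ρu′)) (trans ρx (≡-sym ρx′))
    edges≤ : ∀ b → ∑[ u < n ] ∑[ x < n ] edge b u x ≤ ⟦ not (does (a Fin.≟ b)) ⟧ * 1
    edges≤ b with a Fin.≟ b
    ... | no _     = double-sum≤1 (edge b) (edge≤1 b) edge-unique
    ... | yes refl = ≤-reflexive (sum-zero {n} λ u → sum-zero {n} λ x → none u x)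
      where
      none : ∀ u x → edge a u x ≡ 0
      none u x with edge a u x in eq
      ... | zero  = refl
      ... | suc _ with edge-ends {a} {u} {x} (subst (0 <_) (≡-sym eq) (s≤s z≤n))
      ...   | ρu , ρx , ux = contradiction (trans ρu (≡-sym ρx)) (proj₂ (nonCut⁻ ux))

  private
    own-class : ∀ {a u} → ρ u ≡ a → ⟦ does (ρ u Fin.≟ a) ⟧ * nonCutDegree u ≡ nonCutDegree u
    own-class {a} {u} ρu = trans (cong (λ b → ⟦ b ⟧ * nonCutDegree u) (dec-true (ρ u Fin.≟ a) ρu)) (+-identityʳ _)

  nonCutDegree≤t : ∀ u → nonCutDegree u ≤ t
  nonCutDegree≤t u = ≤-trans (≤-reflexive (≡-sym (own-class refl)))
    (≤-trans (term≤sum (λ v → ⟦ does (ρ v Fin.≟ ρ u) ⟧ * nonCutDegree v) u) (classDegree≤t (ρ u)))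

  nonCutDegree-pair : ∀ {u v} → u ≢ v → ρ u ≡ ρ v → nonCutDegree u + nonCutDegree v ≤ t
  nonCutDegree-pair {u} {v} u≢v ρ≡ = ≤-trans (≤-reflexive (≡-sym (cong₂ _+_ (own-class ρ≡) (own-class refl))))
    (≤-trans (two-terms≤sum (λ w → ⟦ does (ρ w Fin.≟ ρ v) ⟧ * nonCutDegree w) u≢v) (classDegree≤t (ρ v)))

  sum-nonCut≤ : ∑[ u < n ] nonCutDegree u ≤ suc t * t
  sum-nonCut≤ = begin
    ∑[ u < n ] nonCutDegree u        ≡⟨ sum-fibre ρ nonCutDegree ⟩
    ∑[ a < suc t ] classDegree a     ≤⟨ sum-mono classDegree≤t ⟩
    ∑[ a < suc t ] t                 ≡⟨ sum-const (suc t) t ⟩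
    suc t * t                        ∎
    where open ≤-Reasoning

  -- The r cut edges include c(u) + c(v) - [uv] distinct ones that meet u or v. In doubled form, the
  -- cut edges from j towards u or v are at most c(j) in number, and the slack at j = u and j = v
  -- supplies the second copy of c(u) + c(v).
  cutDegree-pair : ∀ {u v} → u ≢ v → cutDegree u + cutDegree v ≤ r + ⟦ cut u v ⟧
  cutDegree-pair {u} {v} u≢v = *-cancelˡ-≤ 2 (begin
    2 * (cutDegree u + cutDegree v)
      ≡⟨ double (cutDegree u + cutDegree v) ⟩
    cutDegree u + cutDegree v + (cutDegree u + cutDegree v)
      ≡⟨ cong (_+ (cutDegree u + cutDegree v)) (trans (≡-sym (∑-distrib-+ (λ j → ⟦ cut u j ⟧) (λ j → ⟦ cut v j ⟧)))
           (sum-cong-≗ λ j → cong₂ (λ a b → ⟦ a ⟧ + ⟦ b ⟧) (cut-sym u j) (cut-sym v j))) ⟩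
    sum towards + (cutDegree u + cutDegree v)
      ≤⟨ two-excesses≤sum (λ j → two-terms≤sum (λ x → ⟦ cut j x ⟧) u≢v) u≢v ⟩
    ∑[ j < n ] cutDegree j + (towards u + towards v)
      ≡⟨ cong₂ _+_ sum-cut (cong₂ _+_ (cong (λ b → ⟦ b ⟧ + ⟦ cut u v ⟧) (cut-irrefl u)) (cong₂ (λ a b → ⟦ a ⟧ + ⟦ b ⟧) (cut-sym v u) (cut-irrefl v))) ⟩
    r + r + (⟦ cut u v ⟧ + (⟦ cut u v ⟧ + 0))
      ≡⟨ regroup r (⟦ cut u v ⟧) ⟩
    2 * (r + ⟦ cut u v ⟧) ∎)
    where
    open ≤-Reasoning
    towards : Fin n → ℕ
    towards j = ⟦ cut j u ⟧ + ⟦ cut j v ⟧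
    double : ∀ x → 2 * x ≡ x + x
    double = solve-∀
    regroup : ∀ r c → r + r + (c + (c + 0)) ≡ 2 * (r + c)
    regroup = solve-∀

  nonCut-cutDegrees≤ : ∑[ i < n ] ∑[ j < n ] (⟦ nonCut i j ⟧ * (cutDegree i + cutDegree j)) ≤ (r + r) * t
  nonCut-cutDegrees≤ = begin
    ∑[ i < n ] ∑[ j < n ] (⟦ nonCut i j ⟧ * (cutDegree i + cutDegree j))
      ≡⟨ weighted-handshake nonCut nonCut-sym cutDegree ⟩
    2 * ∑[ i < n ] (cutDegree i * nonCutDegree i)
      ≡⟨ cong (2 *_) (sum-cong-≗ λ i → *-comm (cutDegree i) (nonCutDegree i)) ⟩
    2 * ∑[ i < n ] (nonCutDegree i * cutDegree i)
      ≡⟨ weighted-handshake cut cut-sym nonCutDegree ⟨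
    ∑[ i < n ] ∑[ j < n ] (⟦ cut i j ⟧ * (nonCutDegree i + nonCutDegree j))
      ≤⟨ sum-mono (λ i → sum-mono (pair i)) ⟩
    ∑[ i < n ] ∑[ j < n ] (⟦ cut i j ⟧ * t)
      ≡⟨ sum-cong-≗ (λ i → ≡-sym (*-distribʳ-sum t (λ j → ⟦ cut i j ⟧))) ⟩
    ∑[ i < n ] (cutDegree i * t)
      ≡⟨ *-distribʳ-sum t cutDegree ⟨
    (∑[ i < n ] cutDegree i) * t
      ≡⟨ cong (_* t) sum-cut ⟩
    (r + r) * t ∎
    where
    open ≤-Reasoning
    pair : ∀ i j → ⟦ cut i j ⟧ * (nonCutDegree i + nonCutDegree j) ≤ ⟦ cut i j ⟧ * t
    pair i j with cut i j in eq
    ... | false = z≤n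
    ... | true  = *-monoʳ-≤ 1 (nonCutDegree-pair (λ { refl → contradiction (trans (≡-sym eq) (cut-irrefl i)) λ () }) (proj₂ (cut⁻ eq)))

-- The pendant clique

sum-splitAt : ∀ t {r} (f : Fin (t + r) → ℕ) → sum f ≡ ∑[ i < t ] f (i ↑ˡ r) + ∑[ j < r ] f (t ↑ʳ j)
sum-splitAt zero    f = refl
sum-splitAt (suc t) f = trans (cong (f zero +_) (sum-splitAt t (f ∘ suc))) (≡-sym (+-assoc (f zero) _ _))

avoid-two : ∀ {t} (a b : Fin (3 + t)) → ∃ λ c → c ≢ a × c ≢ b
avoid-two zero          zero          = suc zero , (λ ()) , λ ()
avoid-two zero          (suc zero)    = suc (suc zero) , (λ ()) , λ ()
avoid-two zero          (suc (suc b)) = suc zero , (λ ()) , λ ()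
avoid-two (suc zero)    zero          = suc (suc zero) , (λ ()) , λ ()
avoid-two (suc (suc a)) zero          = suc zero , (λ ()) , λ ()
avoid-two (suc a)       (suc b)       = zero , (λ ()) , λ ()

KPendant-sym : ∀ n r i j → KPendant n r i j ≡ KPendant n r j i
KPendant-sym n r i j = cong₂ _∧_ (cong not (==-sym i j)) (cong₂ _∨_ (Bool.∧-comm (inK r i) (inK r j)) (Bool.∨-comm (isZero i ∧ not (inK r j)) _))
  where
  ==-sym : ∀ {n} (i j : Fin n) → (i == j) ≡ (j == i)
  ==-sym i j with i Fin.≟ j
  ... | yes refl = refl
  ... | no i≢j   = trans (==-≢ i≢j) (≡-sym (==-≢ (i≢j ∘ ≡-sym)))

KPendant-irrefl : ∀ n r i → KPendant n r i i ≡ false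
KPendant-irrefl n r i rewrite ==-refl i = refl

module Extremal (t r : ℕ) where

  H : Graph (suc t + r)
  H = record
    { adj    = KPendant (suc t + r) r
    ; sym    = KPendant-sym (suc t + r) r
    ; irrefl = KPendant-irrefl (suc t + r) r
    }

  core : Fin (suc t) → Fin (suc t + r)
  core a = a ↑ˡ r

  hub : Fin (suc t + r)
  hub = core zero

  leaf : Fin r → Fin (suc t + r)
  leaf b = suc t ↑ʳ b

  data Vertex : Fin (suc t + r) → Set where
    is-core : ∀ a → Vertex (core a)
    is-leaf : ∀ b → Vertex (leaf b)

  vertex : ∀ i → Vertex i
  vertex i = subst Vertex (Fin.join-splitAt (suc t) r i) (view (splitAt (suc t) i))
    where
    view : ∀ s → Vertex (join (suc t) r s)
    view (inj₁ a) = is-core a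
    view (inj₂ b) = is-leaf b

  core≢leaf : ∀ {a b} → core a ≢ leaf b
  core≢leaf {a} {b} eq = contradiction (begin
    suc t               ≤⟨ m≤m+n (suc t) (toℕ b) ⟩
    suc t + toℕ b       ≡⟨ Fin.toℕ-↑ʳ (suc t) b ⟨
    toℕ (leaf b)        ≡⟨ cong toℕ eq ⟨
    toℕ (core a)        ≡⟨ Fin.toℕ-↑ˡ a r ⟩
    toℕ a               ∎) (<⇒≱ (Fin.toℕ<n a))
    where open ≤-Reasoning

  inK-core : ∀ a → inK {suc t + r} r (core a) ≡ true
  inK-core a rewrite m+n∸n≡m (suc t) r | Fin.toℕ-↑ˡ a r = Equivalence.to Bool.T-≡ (<⇒<ᵇ (Fin.toℕ<n a))

  inK-leaf : ∀ b → inK {suc t + r} r (leaf b) ≡ false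
  inK-leaf b rewrite m+n∸n≡m (suc t) r | Fin.toℕ-↑ʳ t b =
    Bool.¬-not λ eq → ≤⇒≯ (m≤m+n (suc t) (toℕ b)) (<ᵇ⇒< (suc t + toℕ b) (suc t) (Equivalence.from Bool.T-≡ eq))

  adj-core-core : ∀ a b → adj H (core a) (core b) ≡ not (does (a Fin.≟ b))
  adj-core-core a b rewrite inK-core a | inK-core b with a Fin.≟ b
  ... | yes refl = cong (λ x → not x ∧ true) (==-refl (core a))
  ... | no a≢b   = cong (λ x → not x ∧ true) (==-≢ (a≢b ∘ Fin.↑ˡ-injective r a b))

  adj-hub-leaf : ∀ b → adj H hub (leaf b) ≡ true
  adj-hub-leaf b rewrite inK-leaf b | Bool.∧-zeroʳ (inK {suc t + r} r hub) = refl

  adj-core-leaf : ∀ a b → adj H (core (suc a)) (leaf b) ≡ false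
  adj-core-leaf a b rewrite inK-core (suc a) | inK-leaf b = Bool.∧-zeroʳ _

  adj-leaf-leaf : ∀ b c → adj H (leaf b) (leaf c) ≡ false
  adj-leaf-leaf b c rewrite inK-leaf b = Bool.∧-zeroʳ _

  adj-leaf-hub : ∀ b → adj H (leaf b) hub ≡ true
  adj-leaf-hub b = trans (sym H (leaf b) hub) (adj-hub-leaf b)

  adj-leaf-core : ∀ a b → adj H (leaf b) (core (suc a)) ≡ false
  adj-leaf-core a b = trans (sym H (leaf b) (core (suc a))) (adj-core-leaf a b)

  sum-vertices : (f : Fin (suc t + r) → ℕ) → sum f ≡ f hub + (∑[ a < t ] f (core (suc a)) + ∑[ b < r ] f (leaf b))
  sum-vertices f = trans (sum-splitAt (suc t) f) (+-assoc (f hub) _ _)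

  sum-hub : (f : Fin (suc t + r) → ℕ) →
    ∑[ j < suc t + r ] (⟦ adj H hub j ⟧ * f j) ≡ ∑[ a < t ] f (core (suc a)) + ∑[ b < r ] f (leaf b)
  sum-hub f = trans (sum-vertices λ j → ⟦ adj H hub j ⟧ * f j) (cong₂ _+_ (cong (λ b → ⟦ b ⟧ * f hub) (adj-core-core zero zero)) (cong₂ _+_
    (sum-cong-≗ λ a → trans (cong (λ b → ⟦ b ⟧ * f (core (suc a))) (adj-core-core zero (suc a))) (+-identityʳ _))
    (sum-cong-≗ λ b → trans (cong (λ x → ⟦ x ⟧ * f (leaf b)) (adj-hub-leaf b)) (+-identityʳ _))))

  -- A clique vertex other than the hub sees exactly the rest of the clique; its own term, added on
  -- the left, completes the sum over the clique.
  sum-core : (f : Fin (suc t + r) → ℕ) → ∀ a →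
    ∑[ j < suc t + r ] (⟦ adj H (core (suc a)) j ⟧ * f j) + f (core (suc a)) ≡ f hub + ∑[ c < t ] f (core (suc c))
  sum-core f a = begin
    ∑[ j < suc t + r ] (⟦ adj H (core (suc a)) j ⟧ * f j) + f (core (suc a))
      ≡⟨ cong (_+ f (core (suc a))) (sum-vertices λ j → ⟦ adj H (core (suc a)) j ⟧ * f j) ⟩
    ⟦ adj H (core (suc a)) hub ⟧ * f hub
      + (∑[ c < t ] (⟦ adj H (core (suc a)) (core (suc c)) ⟧ * f (core (suc c))) + ∑[ b < r ] (⟦ adj H (core (suc a)) (leaf b) ⟧ * f (leaf b)))
      + f (core (suc a))
      ≡⟨ cong (_+ f (core (suc a))) (cong₂ _+_ (trans (cong (λ b → ⟦ b ⟧ * f hub) (adj-core-core (suc a) zero)) (+-identityʳ _))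
           (cong₂ _+_ (sum-cong-≗ λ c → cong (λ b → ⟦ b ⟧ * f (core (suc c))) (adj-core-core (suc a) (suc c)))
             (sum-zero {r} λ b → cong (λ x → ⟦ x ⟧ * f (leaf b)) (adj-core-leaf a b)))) ⟩
    f hub + (X + 0) + f (core (suc a))
      ≡⟨ regroup (f hub) X (f (core (suc a))) ⟩
    f hub + (X + f (core (suc a)))
      ≡⟨ cong (f hub +_) (sum-without (f ∘ core ∘ suc) a) ⟩
    f hub + ∑[ c < t ] f (core (suc c)) ∎
    where
    open ≡-Reasoning
    X : ℕ
    X = ∑[ c < t ] (⟦ not (does (a Fin.≟ c)) ⟧ * f (core (suc c)))
    regroup : ∀ x y z → x + (y + 0) + z ≡ x + (y + z)
    regroup = solve-∀

  sum-leaf : (f : Fin (suc t + r) → ℕ) → ∀ b → ∑[ j < suc t + r ] (⟦ adj H (leaf b) j ⟧ * f j) ≡ f hub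
  sum-leaf f b = trans (sum-vertices λ j → ⟦ adj H (leaf b) j ⟧ * f j) (trans (cong₂ _+_
    (trans (cong (λ x → ⟦ x ⟧ * f hub) (adj-leaf-hub b)) (+-identityʳ _))
    (cong₂ _+_ (sum-zero {t} λ a → cong (λ x → ⟦ x ⟧ * f (core (suc a))) (adj-leaf-core a b))
      (sum-zero {r} λ c → cong (λ x → ⟦ x ⟧ * f (leaf c)) (adj-leaf-leaf b c))))
    (+-identityʳ _))

  private
    degree-as-sum : ∀ i → degree H i ≡ ∑[ j < suc t + r ] (⟦ adj H i j ⟧ * 1)
    degree-as-sum i = trans (degree≡sum H i) (sum-cong-≗ λ j → ≡-sym (*-identityʳ (⟦ adj H i j ⟧)))
    count : ∀ n → ∑[ i < n ] 1 ≡ n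
    count n = trans (sum-const n 1) (*-identityʳ n)

  degree-hub : degree H hub ≡ t + r
  degree-hub = trans (degree-as-sum hub) (trans (sum-hub (λ _ → 1)) (cong₂ _+_ (count t) (count r)))

  degree-core : ∀ a → degree H (core (suc a)) ≡ t
  degree-core a = +-cancelʳ-≡ 1 _ _ (trans (cong (_+ 1) (degree-as-sum (core (suc a))))
    (trans (sum-core (λ _ → 1) a) (trans (cong suc (count t)) (+-comm 1 t))))

  degree-leaf : ∀ b → degree H (leaf b) ≡ 1
  degree-leaf b = trans (degree-as-sum (leaf b)) (sum-leaf (λ _ → 1) b)

  -- There are t (t - 1) = (t + 1) t - 2 t ordered pairs of clique vertices other than the hub;
  -- the last term is moved to the left so that no subtraction occurs.
  sum-adjacent : (w : ℕ → ℕ → ℕ) → (∀ x y → w x y ≡ w y x) →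
    ∑[ i < suc t + r ] ∑[ j < suc t + r ] (⟦ adj H i j ⟧ * w (degree H i) (degree H j)) + 2 * t * w t t
      ≡ (r + r) * w (t + r) 1 + 2 * t * w (t + r) t + suc t * t * w t t
  sum-adjacent w w-sym = begin
    sum row + 2 * t * B
      ≡⟨ cong (_+ 2 * t * B) (sum-vertices row) ⟩
    row hub + (∑[ a < t ] row (core (suc a)) + ∑[ b < r ] row (leaf b)) + 2 * t * B
      ≡⟨ cong₂ (λ x y → x + (∑[ a < t ] row (core (suc a)) + y) + 2 * t * B) row-hub (trans (sum-cong-≗ row-leaf) (sum-const r C)) ⟩
    t * A + r * C + (∑[ a < t ] row (core (suc a)) + r * C) + 2 * t * B
      ≡⟨ regroup₁ t r A B C _ ⟩
    r * C + r * C + t * A + t * B + (∑[ a < t ] row (core (suc a)) + t * B)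
      ≡⟨ cong (r * C + r * C + t * A + t * B +_) (trans
           (trans (cong (∑[ a < t ] row (core (suc a)) +_) (≡-sym (sum-const t B))) (≡-sym (∑-distrib-+ (row ∘ core ∘ suc) (λ _ → B))))
           (trans (sum-cong-≗ row-core) (sum-const t _))) ⟩
    r * C + r * C + t * A + t * B + t * (A + t * B)
      ≡⟨ regroup₂ t r A B C ⟩
    (r + r) * C + 2 * t * A + suc t * t * B ∎
    where
    open ≡-Reasoning
    A B C : ℕ
    A = w (t + r) t
    B = w t t
    C = w (t + r) 1
    row : Fin (suc t + r) → ℕ
    row i = ∑[ j < suc t + r ] (⟦ adj H i j ⟧ * w (degree H i) (degree H j))
    row-hub : row hub ≡ t * A + r * C
    row-hub = trans (sum-hub (λ j → w (degree H hub) (degree H j))) (cong₂ _+_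
      (trans (sum-cong-≗ λ a → cong₂ w degree-hub (degree-core a)) (sum-const t A))
      (trans (sum-cong-≗ λ b → cong₂ w degree-hub (degree-leaf b)) (sum-const r C)))
    row-core : ∀ a → row (core (suc a)) + B ≡ A + t * B
    row-core a = trans (cong (row (core (suc a)) +_) (≡-sym (cong₂ w (degree-core a) (degree-core a))))
      (trans (sum-core (λ j → w (degree H (core (suc a))) (degree H j)) a) (cong₂ _+_
        (trans (cong₂ w (degree-core a) degree-hub) (w-sym t (t + r)))
        (trans (sum-cong-≗ λ c → cong₂ w (degree-core a) (degree-core c)) (sum-const t B))))
    row-leaf : ∀ b → row (leaf b) ≡ C
    row-leaf b = trans (sum-leaf (λ j → w (degree H (leaf b)) (degree H j)) b)
      (trans (cong₂ w (degree-leaf b) degree-hub) (w-sym 1 (t + r)))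
    regroup₁ : ∀ t r A B C X → t * A + r * C + (X + r * C) + 2 * t * B ≡ r * C + r * C + t * A + t * B + (X + t * B)
    regroup₁ = solve-∀
    regroup₂ : ∀ t r A B C → r * C + r * C + t * A + t * B + t * (A + t * B) ≡ (r + r) * C + 2 * t * A + suc t * t * B
    regroup₂ = solve-∀

  reach-hub : ∀ i → Reach (adj H) i hub
  reach-hub i with vertex i
  ... | is-core zero    = here
  ... | is-core (suc a) = step (adj-core-core (suc a) zero) here
  ... | is-leaf b       = step (adj-leaf-hub b) here

  connected : Connected H
  connected = s≤s z≤n , λ i j → reach-trans (reach-hub i) (reach-sym (sym H) (reach-hub j))

  leaf-isCut : ∀ b → IsCutEdge H (hub , leaf b)
  leaf-isCut b = s≤s z≤n , adj-hub-leaf b , λ (_ , conn) → stuck (conn (leaf b) hub)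
    where
    stuck : ¬ Reach (deleteEdge (adj H) hub (leaf b)) (leaf b) hub
    stuck (step {j = j} e _) with vertex j | deleteEdge⁻ (adj H) {hub} {leaf b} {leaf b} {j} e
    ... | is-core zero    | _ , _ , ≢e = ≢e (refl , refl)
    ... | is-core (suc a) | e′ , _     = contradiction (trans (≡-sym e′) (adj-leaf-core a b)) λ ()
    ... | is-leaf c       | e′ , _     = contradiction (trans (≡-sym e′) (adj-leaf-leaf b c)) λ ()

  -- A third clique vertex c keeps its edges to the whole clique, and the pendent vertices reach it
  -- through the hub. For t = 0 there are no two distinct clique vertices, and t = 1 is the only
  -- case with two but no third.
  core-connected : t ≢ 1 → ∀ {a b} → a ≢ b → ConnectedAdj (deleteEdge (adj H) (core a) (core b))
  core-connected t≢1 {a} {b} a≢b = s≤s z≤n , λ i j → reach-trans (to-c i) (reach-sym (deleteEdge-sym (adj H) (sym H)) (to-c j))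
    where
    third : ∀ s → s ≢ 1 → (a b : Fin (suc s)) → a ≢ b → ∃ λ c → c ≢ a × c ≢ b
    third 0             _   zero zero a≢b = contradiction refl a≢b
    third 1             s≢1 _    _    _   = contradiction refl s≢1
    third (suc (suc s)) _   a    b    _   = avoid-two a b
    c : Fin (suc t)
    c = proj₁ (third t t≢1 a b a≢b)
    c≢a : c ≢ a
    c≢a = proj₁ (proj₂ (third t t≢1 a b a≢b))
    c≢b : c ≢ b
    c≢b = proj₂ (proj₂ (third t t≢1 a b a≢b))
    A : Adj (suc t + r)
    A = deleteEdge (adj H) (core a) (core b)
    core-to-c : ∀ x → Reach A (core x) (core c)
    core-to-c x with x Fin.≟ c
    ... | yes refl = here
    ... | no x≢c = step (deleteEdge⁺ (adj H) (trans (adj-core-core x c) (cong not (dec-false (x Fin.≟ c) x≢c)))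
      (c≢b ∘ Fin.↑ˡ-injective r c b ∘ proj₂) (c≢a ∘ Fin.↑ˡ-injective r c a ∘ proj₂)) here
    to-c : ∀ i → Reach A i (core c)
    to-c i with vertex i
    ... | is-core x = core-to-c x
    ... | is-leaf y = step {j = hub} (deleteEdge⁺ (adj H) {core a} {core b} {leaf y} {hub} (adj-leaf-hub y) (core≢leaf ∘ ≡-sym ∘ proj₁) (core≢leaf ∘ ≡-sym ∘ proj₁)) (core-to-c zero)

  leafEdges : List (Fin (suc t + r) × Fin (suc t + r))
  leafEdges = tabulate λ b → hub , leaf b

  cut⇒leafEdge : t ≢ 1 → ∀ e → IsCutEdge H e → e ∈ leafEdges
  cut⇒leafEdge t≢1 (u , v) (u<v , uv , disconnected) with vertex u | vertex v
  ... | is-core a       | is-core b = contradiction (core-connected t≢1 λ { refl → contradiction (trans (≡-sym uv) (irrefl H (core a))) λ () }) disconnected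
  ... | is-core zero    | is-leaf b = ∈-tabulate⁺ b
  ... | is-core (suc a) | is-leaf b = contradiction (trans (≡-sym uv) (adj-core-leaf a b)) λ ()
  ... | is-leaf b       | is-leaf c = contradiction (trans (≡-sym uv) (adj-leaf-leaf b c)) λ ()
  ... | is-leaf b       | is-core a = contradiction (<-trans (subst (_< toℕ (core a)) (Fin.toℕ-↑ʳ (suc t) b) u<v)
    (subst (_< suc t) (≡-sym (Fin.toℕ-↑ˡ a r)) (Fin.toℕ<n a))) (≤⇒≯ (m≤m+n (suc t) (toℕ b)))

  hasCutEdges : t ≢ 1 → HasCutEdges H r
  hasCutEdges t≢1 = leafEdges , List.length-tabulate _
    , Unique.tabulate⁺ (λ eq → Fin.↑ʳ-injective (suc t) _ _ (cong proj₂ eq))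
    , All.tabulate⁺ leaf-isCut
    , cut⇒leafEdge t≢1

-- Comparison with the pendant clique

double-sum-radicands : ∀ {n} (G : Graph n) (f : ℕ → ℕ) →
  2 * List.sum (map f (sombor-radicands G)) ≡ ∑[ i < n ] ∑[ j < n ] (⟦ adj G i j ⟧ * f (degree G i ^ 2 + degree G j ^ 2))
double-sum-radicands G f = trans
  (cong (λ xs → 2 * List.sum xs) (trans (≡-sym (List.map-∘ (edges G))) (List.map-cong (λ _ → refl) (edges G))))
  (double-sum-edges G (λ i j → f (degree G i ^ 2 + degree G j ^ 2)) λ i j → cong f (+-comm (degree G i ^ 2) (degree G j ^ 2)))

∑² : ∀ {n} → (Fin n → Fin n → ℕ) → ℕ
∑² {n} f = ∑[ i < n ] ∑[ j < n ] f i j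

∑²-cong : ∀ {n} {f g : Fin n → Fin n → ℕ} → (∀ i j → f i j ≡ g i j) → ∑² f ≡ ∑² g
∑²-cong f≡g = sum-cong-≗ λ i → sum-cong-≗ (f≡g i)

∑²-mono : ∀ {n} {f g : Fin n → Fin n → ℕ} → (∀ i j → f i j ≤ g i j) → ∑² f ≤ ∑² g
∑²-mono f≤g = sum-mono λ i → sum-mono (f≤g i)

∑²-+ : ∀ {n} (f g : Fin n → Fin n → ℕ) → ∑² (λ i j → f i j + g i j) ≡ ∑² f + ∑² g
∑²-+ f g = trans (sum-cong-≗ λ i → ∑-distrib-+ (f i) (g i)) (∑-distrib-+ (sum ∘ f) (sum ∘ g))

∑²-* : ∀ {n} (f : Fin n → Fin n → ℕ) x → ∑² (λ i j → f i j * x) ≡ ∑² f * x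
∑²-* f x = trans (sum-cong-≗ λ i → ≡-sym (*-distribʳ-sum x (f i))) (≡-sym (*-distribʳ-sum x (sum ∘ f)))

module Comparison {t r : ℕ} {G : Graph (suc t + r)} (S : CutStructure G r t) where
  open CutStructure S
  open Bounds S

  n : ℕ
  n = suc t + r

  radicand : Fin n → Fin n → ℕ
  radicand i j = degree G i ^ 2 + degree G j ^ 2

  cut-degrees : ∀ {i j} → cut i j ≡ true → 0 < degree G i × 0 < degree G j × degree G i + degree G j ≤ suc (t + r)
  cut-degrees {i} {j} ij = positive (proj₁ (cut⁻ ij)) , positive (trans (sym G j i) (proj₁ (cut⁻ ij))) , (begin
    degree G i + degree G j
      ≡⟨ cong₂ _+_ (degree-split i) (degree-split j) ⟩
    cutDegree i + nonCutDegree i + (cutDegree j + nonCutDegree j)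
      ≡⟨ shuffle (cutDegree i) _ (cutDegree j) _ ⟩
    cutDegree i + cutDegree j + (nonCutDegree i + nonCutDegree j)
      ≤⟨ +-mono-≤ (cutDegree-pair i≢j) (nonCutDegree-pair i≢j (proj₂ (cut⁻ ij))) ⟩
    r + ⟦ cut i j ⟧ + t
      ≡⟨ cong (λ b → r + ⟦ b ⟧ + t) ij ⟩
    r + 1 + t
      ≡⟨ rotate r t ⟩
    suc (t + r) ∎)
    where
    open ≤-Reasoning
    i≢j : i ≢ j
    i≢j refl = contradiction (trans (≡-sym ij) (cut-irrefl i)) λ ()
    shuffle : ∀ a b c d → a + b + (c + d) ≡ a + c + (b + d)
    shuffle = solve-∀
    rotate : ∀ r t → r + 1 + t ≡ suc (t + r)
    rotate = solve-∀
    positive : ∀ {x y} → adj G x y ≡ true → 0 < degree G x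
    positive {x} {y} xy = subst (0 <_) (≡-sym (degree≡sum G x))
      (≤-trans (≤-reflexive (cong ⟦_⟧ (≡-sym xy))) (term≤sum (λ z → ⟦ adj G x z ⟧) y))

  nonCutSum : ℕ
  nonCutSum = ∑² λ i j → ⟦ nonCut i j ⟧

  module Level (k : ℕ) where

    W : Fin n → Fin n → ℕ
    W i j = √ radicand i j at k

    -- A, B and C are the weights in the pendant clique of an edge from the hub to the clique, an
    -- edge between two other clique vertices, and a pendent edge. Since B ≤ A, the truncated
    -- difference Δ is exact.
    A B C Δ cutW nonCutW : ℕ
    A = √ ((t + r) ^ 2 + t ^ 2) at k
    B = √ (t ^ 2 + t ^ 2) at k
    C = √ ((t + r) ^ 2 + 1 ^ 2) at k
    Δ = A ∸ B
    cutW    = ∑² λ i j → ⟦ cut i j ⟧ * W i j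
    nonCutW = ∑² λ i j → ⟦ nonCut i j ⟧ * W i j

    B+Δ≡A : B + Δ ≡ A
    B+Δ≡A = m+[n∸m]≡n (√-mono k (+-monoˡ-≤ (t ^ 2) (^-monoˡ-≤ 2 (m≤m+n t r))))

    cut-term : ∀ i j → ⟦ cut i j ⟧ * W i j ≤ ⟦ cut i j ⟧ * C
    cut-term i j with cut i j in eq
    ... | false = z≤n
    ... | true with cut-degrees eq
    ...   | 0<di , 0<dj , di+dj≤n = *-monoʳ-≤ 1 (√-mono k (sum-of-squares≤ 0<di 0<dj di+dj≤n))

    ∑²-cut-C : ∑² (λ i j → ⟦ cut i j ⟧ * C) ≡ (r + r) * C
    ∑²-cut-C = trans (∑²-* (λ i j → ⟦ cut i j ⟧) C) (cong (_* C) sum-cut)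

    cutW≤ : cutW ≤ (r + r) * C
    cutW≤ = ≤-trans (∑²-mono cut-term) (≤-reflexive ∑²-cut-C)

    -- Retains the shortfall of one cut edge in the bound on the total: `excess≤sum` is applied to
    -- the rows at u, and then to the entries of that row at v.
    cutW-deficit : ∀ {u v} → cut u v ≡ true → cutW + C ≤ (r + r) * C + W u v
    cutW-deficit {u} {v} uv = +-cancelʳ-≤ (rowW + rowC) _ _ (begin
      cutW + C + (rowW + rowC)
        ≡⟨ shuffle cutW C rowW rowC ⟩
      cutW + rowC + (rowW + C)
        ≤⟨ +-mono-≤ (excess≤sum (λ i → sum-mono (cut-term i)) u)
             (≤-trans (≤-reflexive (cong (rowW +_) (weight C))) (≤-trans (excess≤sum (cut-term u) v) (≤-reflexive (cong (rowC +_) (≡-sym (weight (W u v))))))) ⟩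
      ∑² (λ i j → ⟦ cut i j ⟧ * C) + rowW + (rowC + W u v)
        ≡⟨ cong (λ x → x + rowW + (rowC + W u v)) ∑²-cut-C ⟩
      (r + r) * C + rowW + (rowC + W u v)
        ≡⟨ shuffle′ ((r + r) * C) rowW rowC (W u v) ⟩
      (r + r) * C + W u v + (rowW + rowC) ∎)
      where
      open ≤-Reasoning
      rowW rowC : ℕ
      rowW = ∑[ j < n ] (⟦ cut u j ⟧ * W u j)
      rowC = ∑[ j < n ] (⟦ cut u j ⟧ * C)
      weight : ∀ x → x ≡ ⟦ cut u v ⟧ * x
      weight x = trans (≡-sym (+-identityʳ x)) (cong (λ b → ⟦ b ⟧ * x) (≡-sym uv))
      shuffle : ∀ a b c d → a + b + (c + d) ≡ a + d + (c + b)
      shuffle = solve-∀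
      shuffle′ : ∀ a b c d → a + b + (c + d) ≡ a + d + (b + c)
      shuffle′ = solve-∀

    weight≤ : ∀ i j → W i j ≤ √ ((t + cutDegree i) ^ 2 + (t + cutDegree j) ^ 2) at k
    weight≤ i j = √-mono k (+-mono-≤ (^-monoˡ-≤ 2 (degree≤ i)) (^-monoˡ-≤ 2 (degree≤ j)))
      where
      degree≤ : ∀ i → degree G i ≤ t + cutDegree i
      degree≤ i = ≤-trans (≤-reflexive (trans (degree-split i) (+-comm (cutDegree i) _))) (+-monoˡ-≤ (cutDegree i) (nonCutDegree≤t i))

    nonCut-cutDegrees : ∀ {i j} → nonCut i j ≡ true → cutDegree i + cutDegree j ≤ r
    nonCut-cutDegrees {i} {j} ij = ≤-trans (cutDegree-pair i≢j) (≤-reflexive (trans (cong (λ b → r + ⟦ b ⟧) not-cut) (+-identityʳ r)))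
      where
      i≢j : i ≢ j
      i≢j refl = proj₂ (nonCut⁻ ij) refl
      not-cut : cut i j ≡ false
      not-cut with cut i j in eq
      ... | false = refl
      ... | true  = contradiction (proj₂ (cut⁻ eq)) (proj₂ (nonCut⁻ ij))

    -- Convexity with coefficients p = c(i), q = c(j) and s = r - p - q. Since they add up to r and
    -- not to 1, the bound is for r times the weight; `suc B` carries the rounding of the square
    -- roots.
    nonCut-term : ∀ i j → ⟦ nonCut i j ⟧ * W i j * r ≤ ⟦ nonCut i j ⟧ * (cutDegree i + cutDegree j) * Δ + ⟦ nonCut i j ⟧ * (suc B * r)
    nonCut-term i j with nonCut i j in eq
    ... | false = z≤n
    ... | true  = begin
      1 * W i j * r
        ≡⟨ trans (cong (_* r) (+-identityʳ (W i j))) (*-comm (W i j) r) ⟩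
      r * W i j
        ≤⟨ *-monoʳ-≤ r (weight≤ i j) ⟩
      r * √ ((t + p) ^ 2 + (t + q) ^ 2) at k
        ≡⟨ cong (_* √ ((t + p) ^ 2 + (t + q) ^ 2) at k) r≡ ⟩
      (p + q + s) * √ ((t + p) ^ 2 + (t + q) ^ 2) at k
        ≤⟨ √-convex k t p q s ⟩
      (p + q) * suc (√ ((t + (p + q + s)) ^ 2 + t ^ 2) at k) + s * suc B
        ≡⟨ cong (λ x → (p + q) * suc (√ ((t + x) ^ 2 + t ^ 2) at k) + s * suc B) (≡-sym r≡) ⟩
      (p + q) * suc A + s * suc B
        ≡⟨ cong (λ x → (p + q) * suc x + s * suc B) (≡-sym B+Δ≡A) ⟩
      (p + q) * suc (B + Δ) + s * suc B
        ≡⟨ regroup p q s B Δ ⟩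
      1 * (p + q) * Δ + 1 * (suc B * (p + q + s))
        ≡⟨ cong (λ x → 1 * (p + q) * Δ + 1 * (suc B * x)) (≡-sym r≡) ⟩
      1 * (p + q) * Δ + 1 * (suc B * r) ∎
      where
      open ≤-Reasoning
      p q s : ℕ
      p = cutDegree i
      q = cutDegree j
      s = r ∸ (p + q)
      r≡ : r ≡ p + q + s
      r≡ = ≡-sym (m+[n∸m]≡n (nonCut-cutDegrees eq))
      regroup : ∀ p q s B Δ → (p + q) * suc (B + Δ) + s * suc B ≡ 1 * (p + q) * Δ + 1 * (suc B * (p + q + s))
      regroup = solve-∀

    -- Summing `nonCut-term` bounds r times the total, and r also divides the bound (r + r) t on the
    -- sum of cut degrees, so it cancels. For r = 0 nothing can be cancelled, but then both degrees
    -- are at most t and B bounds each weight directly.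
    nonCutW≤ : nonCutW ≤ 2 * t * Δ + nonCutSum * suc B
    nonCutW≤ with r ≟ 0
    ... | no r≢0 = *-cancelʳ-≤ _ _ r {{≢-nonZero r≢0}} (begin
      nonCutW * r
        ≡⟨ ∑²-* (λ i j → ⟦ nonCut i j ⟧ * W i j) r ⟨
      ∑² (λ i j → ⟦ nonCut i j ⟧ * W i j * r)
        ≤⟨ ∑²-mono nonCut-term ⟩
      ∑² (λ i j → ⟦ nonCut i j ⟧ * (cutDegree i + cutDegree j) * Δ + ⟦ nonCut i j ⟧ * (suc B * r))
        ≡⟨ ∑²-+ (λ i j → ⟦ nonCut i j ⟧ * (cutDegree i + cutDegree j) * Δ) (λ i j → ⟦ nonCut i j ⟧ * (suc B * r)) ⟩
      ∑² (λ i j → ⟦ nonCut i j ⟧ * (cutDegree i + cutDegree j) * Δ) + ∑² (λ i j → ⟦ nonCut i j ⟧ * (suc B * r))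
        ≡⟨ cong₂ _+_ (∑²-* (λ i j → ⟦ nonCut i j ⟧ * (cutDegree i + cutDegree j)) Δ) (∑²-* (λ i j → ⟦ nonCut i j ⟧) (suc B * r)) ⟩
      ∑² (λ i j → ⟦ nonCut i j ⟧ * (cutDegree i + cutDegree j)) * Δ + nonCutSum * (suc B * r)
        ≤⟨ +-monoˡ-≤ _ (*-monoˡ-≤ Δ nonCut-cutDegrees≤) ⟩
      (r + r) * t * Δ + nonCutSum * (suc B * r)
        ≡⟨ regroup r t Δ nonCutSum (suc B) ⟩
      (2 * t * Δ + nonCutSum * suc B) * r ∎)
      where
      open ≤-Reasoning
      regroup : ∀ r t D E B → (r + r) * t * D + E * (B * r) ≡ (2 * t * D + E * B) * r
      regroup = solve-∀
    ... | yes r≡0 = begin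
      nonCutW                                  ≤⟨ ∑²-mono term ⟩
      ∑² (λ i j → ⟦ nonCut i j ⟧ * suc B)      ≡⟨ ∑²-* (λ i j → ⟦ nonCut i j ⟧) (suc B) ⟩
      nonCutSum * suc B                        ≤⟨ m≤n+m _ (2 * t * Δ) ⟩
      2 * t * Δ + nonCutSum * suc B            ∎
      where
      open ≤-Reasoning
      term : ∀ i j → ⟦ nonCut i j ⟧ * W i j ≤ ⟦ nonCut i j ⟧ * suc B
      term i j with nonCut i j in eq
      ... | false = z≤n
      ... | true  = *-monoʳ-≤ 1 (m≤n⇒m≤1+n (≤-trans (weight≤ i j) (≤-reflexive (cong (λ x → √ x at k)
          (cong₂ (λ x y → (t + x) ^ 2 + (t + y) ^ 2) (m+n≡0⇒m≡0 (cutDegree i) none) (m+n≡0⇒n≡0 (cutDegree i) none)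
            ⟨ trans ⟩ cong (λ x → x ^ 2 + x ^ 2) (+-identityʳ t))))))
        where
        none : cutDegree i + cutDegree j ≡ 0
        none = n≤0⇒n≡0 (subst (cutDegree i + cutDegree j ≤_) r≡0 (nonCut-cutDegrees eq))

  module Maximal (maximal : SO≤ (Extremal.H t r) G) where

    -- The total rounding error: `adjSum` comes from the successor on each radicand in `SqrtSum≤`,
    -- `nonCutSum` from `suc B` in the convexity bound. Neither depends on k.
    adjSum slack : ℕ
    adjSum = ∑² λ i j → ⟦ adj G i j ⟧
    slack  = nonCutSum + adjSum

    -- The weights A disappear: the pendant clique contributes 2tA, and G contributes 2tΔ, completed
    -- to 2tA by the 2tB moved over in `sum-adjacent`. What is left compares pendent edges with cut
    -- edges and pure clique weights with non-cut edges.
    comparison : ∀ k → let open Level k in (r + r) * C + suc t * t * B ≤ cutW + nonCutSum * B + slack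
    comparison k = +-cancelʳ-≤ (2 * t * A) _ _ (begin
      (r + r) * C + suc t * t * B + 2 * t * A
        ≡⟨ swap ((r + r) * C) (suc t * t * B) (2 * t * A) ⟩
      (r + r) * C + 2 * t * A + suc t * t * B
        ≡⟨ Extremal.sum-adjacent t r (λ x y → √ (x ^ 2 + y ^ 2) at k) (λ x y → cong (λ z → √ z at k) (+-comm (x ^ 2) (y ^ 2))) ⟨
      ∑² (λ i j → ⟦ adj H i j ⟧ * √ (degree H i ^ 2 + degree H j ^ 2) at k) + 2 * t * B
        ≡⟨ cong (_+ 2 * t * B) (double-sum-radicands H (λ a → √ a at k)) ⟨
      2 * List.sum (map (λ a → √ a at k) (sombor-radicands H)) + 2 * t * B
        ≤⟨ +-monoˡ-≤ (2 * t * B) (*-monoʳ-≤ 2 (maximal k)) ⟩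
      2 * List.sum (map (λ a → suc (√ a at k)) (sombor-radicands G)) + 2 * t * B
        ≡⟨ cong (_+ 2 * t * B) (double-sum-radicands G (λ a → suc (√ a at k))) ⟩
      ∑² (λ i j → ⟦ adj G i j ⟧ * suc (W i j)) + 2 * t * B
        ≡⟨ cong (_+ 2 * t * B) (trans (∑²-cong λ i j → separate i j)
             (trans (∑²-+ (λ i j → ⟦ adj G i j ⟧) (λ i j → ⟦ cut i j ⟧ * W i j + ⟦ nonCut i j ⟧ * W i j))
               (cong (adjSum +_) (∑²-+ (λ i j → ⟦ cut i j ⟧ * W i j) (λ i j → ⟦ nonCut i j ⟧ * W i j))))) ⟩
      adjSum + (cutW + nonCutW) + 2 * t * B
        ≤⟨ +-monoˡ-≤ (2 * t * B) (+-monoʳ-≤ adjSum (+-monoʳ-≤ cutW nonCutW≤)) ⟩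
      adjSum + (cutW + (2 * t * Δ + nonCutSum * suc B)) + 2 * t * B
        ≡⟨ regroup adjSum cutW t Δ nonCutSum B ⟩
      cutW + nonCutSum * B + slack + 2 * t * (B + Δ)
        ≡⟨ cong (λ x → cutW + nonCutSum * B + slack + 2 * t * x) B+Δ≡A ⟩
      cutW + nonCutSum * B + slack + 2 * t * A ∎)
      where
      open ≤-Reasoning
      open Level k
      H : Graph n
      H = Extremal.H t r
      separate : ∀ i j → ⟦ adj G i j ⟧ * suc (W i j) ≡ ⟦ adj G i j ⟧ + (⟦ cut i j ⟧ * W i j + ⟦ nonCut i j ⟧ * W i j)
      separate i j = trans (*-suc (⟦ adj G i j ⟧) (W i j)) (cong (⟦ adj G i j ⟧ +_)
        (trans (cong (_* W i j) (adj-split i j)) (*-distribʳ-+ (W i j) (⟦ cut i j ⟧) (⟦ nonCut i j ⟧))))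
      swap : ∀ a b c → a + b + c ≡ a + c + b
      swap = solve-∀
      regroup : ∀ D c t Δ E B → D + (c + (2 * t * Δ + E * suc B)) + 2 * t * B ≡ c + E * B + (E + D) + 2 * t * (B + Δ)
      regroup = solve-∀

    -- A single missing ordered pair would leave B ≤ `slack` at every precision. But a count
    -- strictly below (t + 1) t forces t > 0, and then B is unbounded in k.
    nonCutSum-maximal : nonCutSum ≡ suc t * t
    nonCutSum-maximal with m≤n⇒m<n∨m≡n sum-nonCut≤
    ... | inj₂ eq = eq
    ... | inj₁ lt = contradiction bounded (√-unbounded slack 0<2t²)
      where
      t-positive : ∀ {t m} → m < suc t * t → 0 < t
      t-positive {zero}  ()
      t-positive {suc t} _  = s≤s z≤n
      0<2t² : 0 < t ^ 2 + t ^ 2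
      0<2t² = ≤-trans (m^n>0 t {{>-nonZero (t-positive lt)}} 2) (m≤m+n (t ^ 2) (t ^ 2))
      bounded : ∀ k → √ (t ^ 2 + t ^ 2) at k ≤ slack
      bounded k = +-cancelˡ-≤ (nonCutSum * B) _ _ (+-cancelˡ-≤ ((r + r) * C) _ _ (begin
        (r + r) * C + (nonCutSum * B + B)     ≡⟨ cong ((r + r) * C +_) (+-comm (nonCutSum * B) B) ⟩
        (r + r) * C + suc nonCutSum * B       ≤⟨ +-monoʳ-≤ ((r + r) * C) (*-monoˡ-≤ B lt) ⟩
        (r + r) * C + suc t * t * B           ≤⟨ comparison k ⟩
        cutW + nonCutSum * B + slack          ≤⟨ +-monoˡ-≤ slack (+-monoˡ-≤ (nonCutSum * B) cutW≤) ⟩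
        (r + r) * C + nonCutSum * B + slack   ≡⟨ +-assoc ((r + r) * C) _ _ ⟩
        (r + r) * C + (nonCutSum * B + slack) ∎))
        where
        open ≤-Reasoning
        open Level k

    -- With the clique weights cancelled by `nonCutSum-maximal`, `comparison` and `cutW-deficit`
    -- leave C ≤ W u v + `slack` for all k. So the radicand of uv cannot be smaller than that of a
    -- pendent edge, and the degrees are forced.
    cut-extremal : ∀ {u v} → cut u v ≡ true →
      (degree G u ≡ t + r × degree G v ≡ 1) ⊎ (degree G u ≡ 1 × degree G v ≡ t + r)
    cut-extremal {u} {v} uv with cut-degrees uv
    ... | 0<du , 0<dv , du+dv≤n = sum-of-squares-extremal 0<du 0<dv du+dv≤n (≮⇒≥ λ lt → √-gap-unbounded slack lt bounded)
      where
      bounded : ∀ k → √ ((t + r) ^ 2 + 1 ^ 2) at k ≤ √ radicand u v at k + slack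
      bounded k = +-cancelˡ-≤ (cutW + (r + r) * C) _ _ (+-cancelʳ-≤ (suc t * t * B) _ _ (begin
        cutW + (r + r) * C + C + suc t * t * B
          ≡⟨ shuffle cutW ((r + r) * C) C (suc t * t * B) ⟩
        cutW + C + ((r + r) * C + suc t * t * B)
          ≤⟨ +-mono-≤ (cutW-deficit uv) (comparison k) ⟩
        (r + r) * C + W u v + (cutW + nonCutSum * B + slack)
          ≡⟨ cong (λ x → (r + r) * C + W u v + (cutW + x * B + slack)) nonCutSum-maximal ⟩
        (r + r) * C + W u v + (cutW + suc t * t * B + slack)
          ≡⟨ shuffle′ ((r + r) * C) (W u v) cutW (suc t * t * B) slack ⟩
        cutW + (r + r) * C + (W u v + slack) + suc t * t * B ∎))
        where
        open ≤-Reasoning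
        open Level k
        shuffle : ∀ a b c d → a + b + c + d ≡ a + c + (b + d)
        shuffle = solve-∀
        shuffle′ : ∀ a b c d e → a + b + (c + d + e) ≡ c + a + (b + e) + d
        shuffle′ = solve-∀

-- The extremal graphs

sum-complement : ∀ {n} (p : Fin n → Bool) → ∑[ i < n ] ⟦ not (p i) ⟧ + ∑[ i < n ] ⟦ p i ⟧ ≡ n
sum-complement {n} p = trans (≡-sym (∑-distrib-+ (λ i → ⟦ not (p i) ⟧) (λ i → ⟦ p i ⟧)))
  (trans (sum-cong-≗ λ i → one (p i)) (trans (sum-const n 1) (*-identityʳ n)))
  where
  one : ∀ b → ⟦ not b ⟧ + ⟦ b ⟧ ≡ 1
  one true  = refl
  one false = refl

is : Bool → Bool → Bool
is true  = id
is false = not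

is-≡ : ∀ b {x} → is b x ≡ true → b ≡ x
is-≡ true  eq = ≡-sym eq
is-≡ false eq = ≡-sym (trans (≡-sym (Bool.not-involutive _)) (cong not eq))

is-refl : ∀ b → is b b ≡ true
is-refl true  = refl
is-refl false = refl

-- Two-colourings with equal colour classes differ by a permutation.
match-colours : ∀ {n} (p q : Fin n → Bool) →
  (∀ b → ∑[ i < n ] ⟦ is b (p i) ⟧ ≡ ∑[ i < n ] ⟦ is b (q i) ⟧) →
  Σ (Permutation n n) λ π → ∀ i → p i ≡ q (π ⟨$⟩ʳ i)
match-colours {zero}  p q _ = Perm.id , λ ()
match-colours {suc n} p q same with sum-positive (λ i → ⟦ is (p zero) (q i) ⟧)
  (subst (0 <_) (same (p zero)) (≤-trans (≤-reflexive (≡-sym (cong ⟦_⟧ (is-refl (p zero))))) (m≤m+n _ _)))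
... | j , pos = insert zero j π , λ where
    zero    → p0≡qj
    (suc i) → trans (proj₂ rest i) (cong q (≡-sym (insert-punchIn zero j π i)))
  where
  p0≡qj : p zero ≡ q j
  p0≡qj = is-≡ (p zero) (0<⟦⟧ pos)
  rest : Σ (Permutation n n) λ π → ∀ i → p (suc i) ≡ q (punchIn j (π ⟨$⟩ʳ i))
  rest = match-colours (p ∘ suc) (q ∘ punchIn j) λ b → +-cancelˡ-≡ (⟦ is b (p zero) ⟧) _ _
    (trans (same b) (trans (sum-remove {i = j} (λ i → ⟦ is b (q i) ⟧))
      (cong (λ c → ⟦ is b c ⟧ + ∑[ i < n ] ⟦ is b (q (punchIn j i)) ⟧) (≡-sym p0≡qj))))
  π : Permutation n n
  π = proj₁ rest

bool-ext : ∀ {a b} → (a ≡ true → b ≡ true) → (b ≡ true → a ≡ true) → a ≡ b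
bool-ext {true}          f g = ≡-sym (f refl)
bool-ext {false} {true}  f g = g refl
bool-ext {false} {false} f g = refl

∨-true : ∀ a {b} → a ∨ b ≡ true → a ≡ true ⊎ b ≡ true
∨-true true  _  = inj₁ refl
∨-true false eq = inj₂ eq

module Pendants {t r : ℕ} {G : Graph (suc t + r)} (S : CutStructure G r t)
  (w : Fin (suc t + r))
  (cut-at-w        : ∀ {x y} → Split.cut G (CutStructure.ρ S) x y ≡ true → x ≡ w ⊎ y ≡ w)
  (leaf-no-nonCut  : ∀ {x y} → Split.cut G (CutStructure.ρ S) w x ≡ true → Split.nonCut G (CutStructure.ρ S) x y ≢ true)
  (full            : ∑² (λ i j → ⟦ Split.nonCut G (CutStructure.ρ S) i j ⟧) ≡ suc t * t)
  where
  open CutStructure S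
  open Bounds S

  n : ℕ
  n = suc t + r

  pendant inner : Fin n → Bool
  pendant = cut w
  inner   = not ∘ pendant

  -- The cut edges form a star at w: away from w, a vertex can have a cut edge only to w. Summing
  -- over i counts the star twice, which yields `cutDegree-w`.
  cut-row : ∀ i → cutDegree i ≡ ⟦ does (w Fin.≟ i) ⟧ * cutDegree w + ⟦ cut i w ⟧
  cut-row i with w Fin.≟ i
  ... | yes refl rewrite cut-irrefl w = ≡-sym (trans (+-identityʳ _) (+-identityʳ _))
  ... | no w≢i = trans (sum-cong-≗ only-w) (sum-delta (λ _ → ⟦ cut i w ⟧) w)
    where
    only-w : ∀ j → ⟦ cut i j ⟧ ≡ ⟦ does (w Fin.≟ j) ⟧ * ⟦ cut i w ⟧
    only-w j with w Fin.≟ j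
    ... | yes refl = ≡-sym (+-identityʳ _)
    ... | no w≢j   = cong ⟦_⟧ (Bool.¬-not λ ij → Sum.[ w≢i ∘ ≡-sym , w≢j ∘ ≡-sym ] (cut-at-w ij))

  cutDegree-w : cutDegree w ≡ r
  cutDegree-w = *-cancelˡ-≡ _ _ 2 (begin
    2 * cutDegree w
      ≡⟨ cong (cutDegree w +_) (+-identityʳ (cutDegree w)) ⟩
    cutDegree w + cutDegree w
      ≡⟨ cong₂ _+_ (≡-sym (sum-delta (λ _ → cutDegree w) w)) (sum-cong-≗ λ i → cong ⟦_⟧ (cut-sym w i)) ⟩
    ∑[ i < n ] (⟦ does (w Fin.≟ i) ⟧ * cutDegree w) + ∑[ i < n ] ⟦ cut i w ⟧
      ≡⟨ ∑-distrib-+ (λ i → ⟦ does (w Fin.≟ i) ⟧ * cutDegree w) (λ i → ⟦ cut i w ⟧) ⟨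
    ∑[ i < n ] (⟦ does (w Fin.≟ i) ⟧ * cutDegree w + ⟦ cut i w ⟧)
      ≡⟨ sum-cong-≗ cut-row ⟨
    ∑[ i < n ] cutDegree i
      ≡⟨ sum-cut ⟩
    r + r
      ≡⟨ cong (r +_) (+-identityʳ r) ⟨
    2 * r ∎)
    where open ≡-Reasoning

  -- The hub w counts as inner because `cut w w` is false; removing the r pendent vertices leaves
  -- the t + 1 vertices of the future clique.
  inner-count : ∑[ i < n ] ⟦ inner i ⟧ ≡ suc t
  inner-count = +-cancelʳ-≡ r _ _ (trans (cong (∑[ i < n ] ⟦ inner i ⟧ +_) (≡-sym cutDegree-w)) (sum-complement pendant))

  innerPair : Fin n → Fin n → ℕ
  innerPair i j = ⟦ inner i ⟧ * (⟦ not (does (i Fin.≟ j)) ⟧ * ⟦ inner j ⟧)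

  sum-innerPair : ∑² innerPair ≡ suc t * t
  sum-innerPair = begin
    ∑² innerPair                       ≡⟨ sum-cong-≗ row ⟩
    ∑[ i < n ] (⟦ inner i ⟧ * t)       ≡⟨ *-distribʳ-sum t (λ i → ⟦ inner i ⟧) ⟨
    (∑[ i < n ] ⟦ inner i ⟧) * t       ≡⟨ cong (_* t) inner-count ⟩
    suc t * t                          ∎
    where
    open ≡-Reasoning
    row : ∀ i → ∑[ j < n ] innerPair i j ≡ ⟦ inner i ⟧ * t
    row i = trans (≡-sym (*-distribˡ-sum (⟦ inner i ⟧) (λ j → ⟦ not (does (i Fin.≟ j)) ⟧ * ⟦ inner j ⟧))) others
      where
      others : ⟦ inner i ⟧ * ∑[ j < n ] (⟦ not (does (i Fin.≟ j)) ⟧ * ⟦ inner j ⟧) ≡ ⟦ inner i ⟧ * t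
      others with inner i in eq
      ... | false = refl
      ... | true  = cong (_+ 0) (+-cancelʳ-≡ 1 _ _ (trans (cong (λ b → ∑[ j < n ] (⟦ not (does (i Fin.≟ j)) ⟧ * ⟦ inner j ⟧) + ⟦ b ⟧) (≡-sym eq))
        (trans (sum-without (λ j → ⟦ inner j ⟧) i) (trans inner-count (+-comm 1 t)))))

  inner-left : ∀ {i j} → nonCut i j ≡ true → inner i ≡ true
  inner-left ij = cong not (Bool.¬-not λ pendant-i → leaf-no-nonCut pendant-i ij)

  nonCut≤innerPair : ∀ i j → ⟦ nonCut i j ⟧ ≤ innerPair i j
  nonCut≤innerPair i j with nonCut i j in eq
  ... | false = z≤n
  ... | true = ≤-reflexive (≡-sym (cong₂ (λ a b → ⟦ a ⟧ * b) (inner-left eq)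
    (cong₂ (λ a b → ⟦ not a ⟧ * ⟦ b ⟧) (dec-false (i Fin.≟ j) λ { refl → proj₂ (nonCut⁻ eq) refl }) (inner-left (trans (nonCut-sym j i) eq)))))

  -- Non-cut edges join distinct inner vertices, and there are (t + 1) t ordered pairs of either
  -- kind. A pointwise inequality with equal totals is an equality, so the inner vertices form a
  -- clique.
  nonCut≡innerPair : ∀ i j → ⟦ nonCut i j ⟧ ≡ innerPair i j
  nonCut≡innerPair i = sum-extremal (nonCut≤innerPair i) (≤-reflexive (≡-sym
    (sum-extremal (λ i → sum-mono (nonCut≤innerPair i)) (≤-reflexive (trans sum-innerPair (≡-sym full))) i)))

  spoke : Fin n → Fin n → Bool
  spoke i j = does (w Fin.≟ i) ∧ pendant j

  -- Written in the Boolean shape of `KPendant`, with equality to w for `isZero` and `inner` for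
  -- `inK`. An isomorphism then only has to respect these two predicates.
  adjacency : ∀ i j → adj G i j ≡ not (does (i Fin.≟ j)) ∧ ((inner i ∧ inner j) ∨ spoke i j ∨ spoke j i)
  adjacency i j with i Fin.≟ j
  ... | yes refl = irrefl G i
  ... | no i≢j   = bool-ext adjacent⇒
    (Sum.[ inner⇒adjacent , Sum.[ spoke⇒adjacent , trans (sym G i j) ∘ spoke⇒adjacent ] ∘ ∨-true _ ] ∘ ∨-true _)
    where
    cut⇒spoke : ∀ {i j} → cut i j ≡ true → i ≡ w → spoke i j ≡ true
    cut⇒spoke ij refl = cong₂ _∧_ (dec-true (w Fin.≟ w) refl) ij
    spoke⇒adjacent : ∀ {i j} → spoke i j ≡ true → adj G i j ≡ true
    spoke⇒adjacent {i} {j} eq with ∧-true {does (w Fin.≟ i)} eq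
    ... | w≡i , pj = subst (λ x → adj G x j ≡ true) (does⇒ (w Fin.≟ i) w≡i) (proj₁ (cut⁻ pj))
    adjacent⇒ : adj G i j ≡ true → (inner i ∧ inner j) ∨ spoke i j ∨ spoke j i ≡ true
    adjacent⇒ ij with ρ i Fin.≟ ρ j
    ... | yes ρ≡ = trans (cong ((inner i ∧ inner j) ∨_) (Sum.[
        (λ i≡w → cong (_∨ spoke j i) (cut⇒spoke (cut⁺ ij ρ≡) i≡w)) ,
        (λ j≡w → trans (cong (spoke i j ∨_) (cut⇒spoke (trans (cut-sym j i) (cut⁺ ij ρ≡)) j≡w)) (Bool.∨-zeroʳ _))
      ] (cut-at-w (cut⁺ ij ρ≡)))) (Bool.∨-zeroʳ _)
    ... | no ρ≢ = cong (_∨ (spoke i j ∨ spoke j i)) (cong₂ _∧_ (inner-left ij′) (inner-left (trans (nonCut-sym j i) ij′)))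
      where
      ij′ : nonCut i j ≡ true
      ij′ = nonCut⁺ ij ρ≢
    inner⇒adjacent : inner i ∧ inner j ≡ true → adj G i j ≡ true
    inner⇒adjacent eq with ∧-true {inner i} eq
    ... | inner-i , inner-j = proj₁ (nonCut⁻ (0<⟦⟧ (≤-reflexive (≡-sym (trans (nonCut≡innerPair i j)
      (cong₂ (λ a b → ⟦ a ⟧ * b) inner-i (cong₂ (λ a b → ⟦ not a ⟧ * ⟦ b ⟧) (dec-false (i Fin.≟ j) i≢j) inner-j)))))))

  open Extremal t r using (core; leaf; inK-core; inK-leaf; sum-vertices)

  private
    outer-H : Fin n → Bool
    outer-H = not ∘ inK r

    count-outer-H : ∑[ i < n ] ⟦ outer-H i ⟧ ≡ r
    count-outer-H = trans (sum-vertices (λ i → ⟦ outer-H i ⟧)) (trans (cong₂ _+_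
      (cong (λ b → ⟦ not b ⟧) (inK-core zero)) (cong₂ _+_
        (sum-zero {t} λ a → cong (λ b → ⟦ not b ⟧) (inK-core (suc a)))
        (trans (sum-cong-≗ {r} λ b → cong (λ x → ⟦ not x ⟧) (inK-leaf b)) (trans (sum-const r 1) (*-identityʳ r)))))
      refl)

    pendant-w : pendant w ≡ false
    pendant-w = cut-irrefl w

    pendants-match : ∑[ i < t + r ] ⟦ pendant (punchIn w i) ⟧ ≡ ∑[ i < t + r ] ⟦ outer-H (suc i) ⟧
    pendants-match = trans
      (+-cancelˡ-≡ (⟦ pendant w ⟧) _ _ (trans (≡-sym (sum-remove {i = w} (λ i → ⟦ pendant i ⟧))) (trans cutDegree-w
        (≡-sym (cong (λ b → ⟦ b ⟧ + r) pendant-w)))))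
      (≡-sym (trans (cong (λ b → ⟦ not b ⟧ + ∑[ i < t + r ] ⟦ outer-H (suc i) ⟧) (≡-sym (inK-core zero))) count-outer-H))

    colours-match : ∀ b → ∑[ i < t + r ] ⟦ is b (pendant (punchIn w i)) ⟧ ≡ ∑[ i < t + r ] ⟦ is b (outer-H (suc i)) ⟧
    colours-match true  = pendants-match
    colours-match false = +-cancelʳ-≡ (∑[ i < t + r ] ⟦ pendant (punchIn w i) ⟧) _ _ (trans
      (sum-complement (pendant ∘ punchIn w))
      (≡-sym (trans (cong (∑[ i < t + r ] ⟦ not (outer-H (suc i)) ⟧ +_) pendants-match) (sum-complement (outer-H ∘ suc)))))

    π : Permutation (t + r) (t + r)
    π = proj₁ (match-colours (pendant ∘ punchIn w) (outer-H ∘ suc) colours-match)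

    π-colour : ∀ i → pendant (punchIn w i) ≡ outer-H (suc (π ⟨$⟩ʳ i))
    π-colour = proj₂ (match-colours (pendant ∘ punchIn w) (outer-H ∘ suc) colours-match)

    -- The hub is sent to vertex 0, and the other vertices are matched by colour, pendent ones with
    -- the vertices outside the clique.
    σ : Permutation n n
    σ = insert w zero π

    f : Fin n → Fin n
    f = σ ⟨$⟩ʳ_

    f-w : f w ≡ zero
    f-w with w Fin.≟ w
    ... | yes _  = refl
    ... | no w≢w = contradiction refl w≢w

    f-punchIn : ∀ k → f (punchIn w k) ≡ suc (π ⟨$⟩ʳ k)
    f-punchIn k = insert-punchIn w zero π k

    data View : Fin n → Set where
      hub   : View w
      other : ∀ k → View (punchIn w k)

    view : ∀ i → View i
    view i with w Fin.≟ i
    ... | yes refl = hub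
    ... | no w≢i   = subst View (Fin.punchIn-punchOut w≢i) (other (punchOut w≢i))

    f-hub : ∀ i → isZero (f i) ≡ does (w Fin.≟ i)
    f-hub i with view i
    ... | hub     = trans (cong isZero f-w) (≡-sym (dec-true (w Fin.≟ w) refl))
    ... | other k = trans (cong isZero (f-punchIn k)) (≡-sym (dec-false (w Fin.≟ punchIn w k) (Fin.punchInᵢ≢i w k ∘ ≡-sym)))

    f-inner : ∀ i → inK r (f i) ≡ inner i
    f-inner i with view i
    ... | hub     = trans (cong (inK r) f-w) (trans (inK-core zero) (≡-sym (cong not pendant-w)))
    ... | other k = trans (cong (inK r) (f-punchIn k)) (trans (≡-sym (Bool.not-involutive _)) (cong not (≡-sym (π-colour k))))

    f-== : ∀ i j → (f i == f j) ≡ does (i Fin.≟ j)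
    f-== i j with i Fin.≟ j
    ... | yes refl = ==-refl (f i)
    ... | no i≢j   = ==-≢ (i≢j ∘ Injection.injective (↔⇒↣ σ))

  isomorphic : IsomorphicTo G (KPendant n r)
  isomorphic = σ , λ i j → trans (adjacency i j) (≡-sym (KPendant-f i j))
    where
    KPendant-f : ∀ i j → KPendant n r (f i) (f j) ≡ not (does (i Fin.≟ j)) ∧
      ((inner i ∧ inner j) ∨ spoke i j ∨ spoke j i)
    KPendant-f i j = cong₂ _∧_ (cong not (f-== i j)) (cong₂ _∨_ (cong₂ _∧_ (f-inner i) (f-inner j))
      (cong₂ _∨_ (cong₂ _∧_ (f-hub i) (outer j)) (cong₂ _∧_ (f-hub j) (outer i))))
      where
      outer : ∀ i → not (inK r (f i)) ≡ pendant i
      outer i = trans (cong not (f-inner i)) (Bool.not-involutive (pendant i))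

-- Locating the common hub of the cut edges

module _ {n : ℕ} (G : Graph n) where

  degree-one : ∀ {x y z} → degree G x ≡ 1 → adj G x y ≡ true → adj G x z ≡ true → y ≡ z
  degree-one {x} {y} {z} dx xy xz with y Fin.≟ z
  ... | yes y≡z = y≡z
  ... | no y≢z  = contradiction (begin
    2                                  ≡⟨ cong₂ (λ a b → ⟦ a ⟧ + ⟦ b ⟧) xy xz ⟨
    ⟦ adj G x y ⟧ + ⟦ adj G x z ⟧      ≤⟨ two-terms≤sum (λ j → ⟦ adj G x j ⟧) y≢z ⟩
    ∑[ j < n ] ⟦ adj G x j ⟧           ≡⟨ trans (≡-sym (degree≡sum G x)) dx ⟩
    1                                  ∎) λ { (s≤s ()) }
    where open ≤-Reasoning

  full-degree : ∀ {x y} → suc (degree G x) ≡ n → x ≢ y → adj G x y ≡ true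
  full-degree {x} {y} dx x≢y = 0<⟦⟧ (subst (0 <_) (≡-sym (sum-extremal bound (+-cancelʳ-≤ 1 _ _ total) y)) positive)
    where
    bound : ∀ j → ⟦ adj G x j ⟧ ≤ ⟦ not (does (x Fin.≟ j)) ⟧ * 1
    bound j with x Fin.≟ j
    ... | yes refl = ≤-reflexive (cong ⟦_⟧ (irrefl G x))
    ... | no _     = ⟦⟧≤1 (adj G x j)
    total : ∑[ j < n ] (⟦ not (does (x Fin.≟ j)) ⟧ * 1) + 1 ≤ ∑[ j < n ] ⟦ adj G x j ⟧ + 1
    total = ≤-reflexive (trans (sum-without (λ _ → 1) x) (trans (sum-const n 1) (trans (*-identityʳ n)
      (trans (≡-sym dx) (trans (+-comm 1 (degree G x)) (cong (_+ 1) (degree≡sum G x)))))))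
    positive : 0 < ⟦ not (does (x Fin.≟ y)) ⟧ * 1
    positive rewrite dec-false (x Fin.≟ y) x≢y = ≤-refl

module Extremality {t r : ℕ} {G : Graph (suc t + r)} (S : CutStructure G r t)
  (cut-extremal : ∀ {u v} → Split.cut G (CutStructure.ρ S) u v ≡ true →
    (degree G u ≡ t + r × degree G v ≡ 1) ⊎ (degree G u ≡ 1 × degree G v ≡ t + r)) where
  open CutStructure S
  open Bounds S

  IsHub : Fin (suc t + r) → Set
  IsHub w = (∀ {x y} → cut x y ≡ true → x ≡ w ⊎ y ≡ w) × (∀ {x y} → cut w x ≡ true → nonCut x y ≢ true)

  not-both : ∀ {x y} → cut x y ≡ true → nonCut x y ≢ true
  not-both xy xy′ = proj₂ (nonCut⁻ xy′) (proj₂ (cut⁻ xy))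

  -- A vertex of degree n - 1 is adjacent to p unless it is p itself, and w is the only neighbour of
  -- p. So the large end of any cut edge is w, or it is p and the other end is w.
  edge⇒hub : ∀ {w p} → cut w p ≡ true → degree G w ≡ t + r → degree G p ≡ 1 → IsHub w
  edge⇒hub {w} {p} wp dw dp = at-w , no-nonCut
    where
    pw : adj G p w ≡ true
    pw = proj₁ (cut⁻ (trans (cut-sym p w) wp))
    full-end : ∀ {x y} → cut x y ≡ true → degree G x ≡ t + r → x ≡ w ⊎ y ≡ w
    full-end {x} {y} xy dx with x Fin.≟ p
    ... | yes refl = inj₂ (degree-one G dp (proj₁ (cut⁻ xy)) pw)
    ... | no x≢p   = inj₁ (degree-one G dp (trans (sym G p x) (full-degree G (cong suc dx) x≢p)) pw)
    at-w : ∀ {x y} → cut x y ≡ true → x ≡ w ⊎ y ≡ w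
    at-w {x} {y} xy with cut-extremal xy
    ... | inj₁ (dx , _) = full-end xy dx
    ... | inj₂ (_ , dy) = Sum.swap (full-end (trans (cut-sym y x) xy) dy)
    leaf-degree : ∀ {x} → cut w x ≡ true → degree G x ≡ 1
    leaf-degree wx with cut-extremal wx
    ... | inj₁ (_ , dx)  = dx
    -- This alternative gives w both degree t + r and degree 1, so the two values coincide and x has
    -- degree 1 as well.
    ... | inj₂ (dw′ , dx) = trans dx (trans (≡-sym dw) dw′)
    no-nonCut : ∀ {x y} → cut w x ≡ true → nonCut x y ≢ true
    no-nonCut {x} {y} wx xy with degree-one G (leaf-degree wx) (proj₁ (nonCut⁻ xy)) (proj₁ (cut⁻ (trans (cut-sym x w) wx)))
    ... | refl = not-both (trans (cut-sym x w) wx) xy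

  ∃-hub : ∃ IsHub
  ∃-hub with ∑[ i < suc t + r ] cutDegree i in eq
  -- Without cut edges every vertex is a hub vacuously; vertex 0 is taken.
  ... | zero = zero , (λ xy → contradiction xy (none _ _)) , λ wx → contradiction wx (none _ _)
    where
    none : ∀ x y → cut x y ≢ true
    none x y xy = contradiction (begin
      1                                ≡⟨ cong ⟦_⟧ xy ⟨
      ⟦ cut x y ⟧                      ≤⟨ term≤sum (λ j → ⟦ cut x j ⟧) y ⟩
      cutDegree x                      ≤⟨ term≤sum cutDegree x ⟩
      ∑[ i < suc t + r ] cutDegree i   ≡⟨ eq ⟩
      0                                ∎) λ ()
      where open ≤-Reasoning
  ... | suc _ with sum-positive cutDegree (subst (0 <_) (≡-sym eq) (s≤s z≤n))
  ...   | x , 0<cx with sum-positive (λ j → ⟦ cut x j ⟧) 0<cx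
  ...     | y , 0<xy with cut-extremal (0<⟦⟧ 0<xy)
  ...       | inj₁ (dx , dy) = x , edge⇒hub (0<⟦⟧ 0<xy) dx dy
  ...       | inj₂ (dx , dy) = y , edge⇒hub (trans (cut-sym y x) (0<⟦⟧ 0<xy)) dy dx

theorem3p7 : (n r : ℕ) (G : Graph n) →
    Connected G → HasCutEdges G r →
    (∀ (H : Graph n) → Connected H → HasCutEdges H r → SO≤ H G) →
    IsomorphicTo G (KPendant n r)
theorem3p7 n r G conn hasCut maximal with cutStructure G conn hasCut
... | t , S with CutStructure.order S
...   | refl = Pendants.isomorphic S (proj₁ hub) (proj₁ (proj₂ hub)) (proj₂ (proj₂ hub)) M.nonCutSum-maximal
  where
  module E = Extremal t r
  -- The field `t≢1`, derived from G, is what certifies that the pendant clique has exactly r cut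
  -- edges and may be compared with G.
  module M = Comparison.Maximal S (maximal E.H E.connected (E.hasCutEdges (CutStructure.t≢1 S)))
  hub : ∃ (Extremality.IsHub S M.cut-extremal)
  hub = Extremality.∃-hub S M.cut-extremal
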